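{- For every integer $n\ge1$, let $\gamma^{\mathrm{pnest}}_{\mathcal A(2n)}(t)$ be the gamma-polynomial of the symmetric polynomial $\mathrm{Pnest}_{\mathcal A(2n)}(t)/t$, where $\mathrm{Pnest}_{\mathcal A(m)}(t)=\sum_{\mathbf a\in\mathcal A(m)}t^{\mathrm{pnest}(\mathbf a)}$. Then $$\gamma^{\mathrm{pnest}}_{\mathcal A(2n)}(t)=\sum_{i=0}^{\lfloor\frac{n-1}{2}\rfloor}2^{2i+1}\binom{n}{2i+1}t^i=\frac{(1+2\sqrt t)^n-(1-2\sqrt t)^n}{2\sqrt t}.$$ Moreover, for each such $i$, $2^{2i+1}\binom{n}{2i+1}$ is the number of Abelian Dyck paths $(k,L)$ of semilength $2n$ with peak-nesting $i+1$ such that, writing the augmented word $LN=S_1S_2\cdots S_{2n}S_{2n+1}$ (obtained by appending a step $N$ to $L$), there is no $j\in[n]$ with $S_{2j-1}S_{2j}S_{2j+1}=ENE$ or $S_{2j-1}S_{2j}S_{2j+1}=NEN$.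
   Context: Write $[n]=\{1,\dots,n\}$. An area sequence of size $m$ is a sequence $\mathbf a=(a_1,\dots,a_m)$ of nonnegative integers with $a_i<i$ for all $i$ and $a_i\le a_{i-1}+1$ for all $i\ge 2$. Each area sequence $\mathbf a$ defines a graph $\Gamma_{\mathbf a}$ (a unit interval graph) on $[m]$ with edges $\{j,i\}$ for $1\le j<i\le m$ with $i-a_i\le j$. If $\{i,j\}$ with $i<j$ is an edge then $\{i,i+1,\dots,j\}$ is a clique. A peak-edge of $\Gamma_{\mathbf a}$ is either an isolated vertex $i$ (put $j=i$) or an edge $\{i,j\}$, $i<j$, such that neither $\{i,j+1\}$ nor $\{i-1,j\}$ is an edge (pairs not contained in $[m]$ are not edges). The corresponding peak-clique is $\{i,\dots,j\}$. The peak-nesting of a vertex is the number of peak-cliques containing it, and $\mathrm{pnest}(\mathbf a)$ is the maximum over all vertices. $\mathbf a$ is Abelian if every vertex $i\ne 1,m$ of $\Gamma_{\mathbf a}$ is adjacent to at least one of $1$ and $m$; $\mathcal A(m)$ is the set of Abelian area sequences of size $m$. Area sequences of size $m$ correspond bijectively to Dyck paths of semilength $m$, i.e. lattice paths from $(0,0)$ to $(m,m)$ with steps $N=(0,1)$, $E=(1,0)$ staying weakly above the diagonal: the $i$-th $N$ step of the path lies on the line $x=i-1-a_i$. Statistics of $\mathbf a$ are transferred to its Dyck path. A Dyck path is Abelian if its area sequence is. Every Abelian Dyck path of semilength $m$ is uniquely of the form $N^kLE^{m-k}$ with $1\le k\le m$ and $L$ a path with steps $N,E$ from $(0,k)$ to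 $(k,m)$ whose first step is $E$; it is denoted $(k,L)$, and conversely each such pair gives an Abelian Dyck path. A polynomial $p(t)$ of degree $d$ is symmetric if $p(t)=t^dp(1/t)$; then $p(t)=\sum_{0\le 2i\le d}\gamma_it^i(1+t)^{d-2i}$ uniquely and $\gamma_p(t)=\sum_i\gamma_it^i$ is its gamma-polynomial. -}

module Defs where

open import Data.Nat as ℕ using (ℕ; zero; suc; _∸_; _≤_; _<_; _≤?_; _<?_)
open import Data.Nat.DivMod using (_/_)
open import Data.Integer as ℤ using (ℤ; 0ℤ; 1ℤ)
open import Data.Fin as Fin using (Fin; toℕ)
import Data.Fin.Properties as Fin
open import Data.Vec as Vec using (Vec; lookup)
open import Data.List as List using (List; []; _∷_; _++_)
import Data.List.Properties as List
open import Data.List.Extrema.Nat using (max)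
open import Data.List.Relation.Unary.All as All using (All)
open import Data.Maybe using (Maybe; just)
import Data.Maybe.Properties as Maybe
open import Data.Product using (_×_; _,_; ∃-syntax)
open import Data.Sum using (_⊎_)
open import Relation.Binary.Definitions using (DecidableEquality)
open import Relation.Binary.PropositionalEquality using (_≡_; _≢_; refl)
open import Relation.Nullary using (¬_; Dec; yes; no)
open import Relation.Nullary.Decidable using (_×-dec_; _⊎-dec_; _→-dec_; ¬?)
open import Relation.Unary using (Decidable)

-- All vectors of length n over the alphabet xs, each occurring once when xs
-- has no repetitions.
words : {A : Set} → List A → (n : ℕ) → List (Vec A n)
words xs zero    = Vec.[] ∷ []
words xs (suc n) = List.cartesianProductWith Vec._∷_ xs (words xs n)

------------------------------------------------------------------------
-- Polynomials with integer coefficients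

-- Coefficients are listed from the constant term upwards.  Trailing zeros are
-- allowed, so equality of polynomials is _≈_ and not _≡_.
Poly : Set
Poly = List ℤ

coeff : Poly → ℕ → ℤ
coeff []      _       = 0ℤ
coeff (c ∷ p) zero    = c
coeff (c ∷ p) (suc i) = coeff p i

infix 4 _≈_
_≈_ : Poly → Poly → Set
p ≈ q = ∀ i → coeff p i ≡ coeff q i

const : ℤ → Poly
const c = c ∷ []

X : Poly
X = 0ℤ ∷ 1ℤ ∷ []

infixl 6 _⊕_ _⊖_
infixl 7 _⊗_
infixr 8 _^ₚ_

_⊕_ : Poly → Poly → Poly
[]      ⊕ q       = q
(c ∷ p) ⊕ []      = c ∷ p
(c ∷ p) ⊕ (d ∷ q) = (c ℤ.+ d) ∷ (p ⊕ q)

_⊖_ : Poly → Poly → Poly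
p ⊖ q = p ⊕ List.map ℤ.-_ q

_⊗_ : Poly → Poly → Poly
[]      ⊗ q = []
(c ∷ p) ⊗ q = List.map (c ℤ.*_) q ⊕ (0ℤ ∷ (p ⊗ q))

_^ₚ_ : Poly → ℕ → Poly
p ^ₚ zero  = const 1ℤ
p ^ₚ suc n = p ⊗ (p ^ₚ n)

sumₚ : List Poly → Poly
sumₚ = List.foldr _⊕_ []

-- ∑≤ N f is the sum of f i over 0 ≤ i ≤ N.
∑≤ : ℕ → (ℕ → Poly) → Poly
∑≤ N f = sumₚ (List.map f (List.upTo (suc N)))

-- p ∘ₚ q is p(q(t)), by Horner's rule.
_∘ₚ_ : Poly → Poly → Poly
[]      ∘ₚ q = []
(c ∷ p) ∘ₚ q = const c ⊕ q ⊗ (p ∘ₚ q)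

HasDegree : Poly → ℕ → Set
HasDegree p d = coeff p d ≢ 0ℤ × (∀ i → d < i → coeff p i ≡ 0ℤ)

-- For p of degree at most d, this is tᵈ p(1/t).
reciprocal : ℕ → Poly → Poly
reciprocal d p = List.applyUpTo (λ i → coeff p (d ∸ i)) (suc d)

SymmetricOfDegree : ℕ → Poly → Set
SymmetricOfDegree d p = HasDegree p d × p ≈ reciprocal d p

-- γ is the gamma-polynomial of the symmetric polynomial p.  The expansion only
-- involves γᵢ with 2i ≤ d; the vanishing condition says that γ has no other
-- coefficients.
IsGammaPolynomial : Poly → Poly → Set
IsGammaPolynomial p γ = ∃[ d ]
    SymmetricOfDegree d p
  × (∀ i → d < 2 ℕ.* i → coeff γ i ≡ 0ℤ)
  × p ≈ ∑≤ (d / 2) (λ i →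
          const (coeff γ i) ⊗ X ^ₚ i ⊗ (const 1ℤ ⊕ X) ^ₚ (d ∸ 2 ℕ.* i))

------------------------------------------------------------------------
-- Area sequences and unit interval graphs

-- The index i : Fin m stands for the element toℕ i + 1 of [m]; thus the
-- condition aᵢ < i becomes lookup a i ≤ toℕ i, while conditions that compare
-- two elements of [m] are unaffected by the shift.
IsAreaSequence : ∀ {m} → Vec ℕ m → Set
IsAreaSequence {m} a =
    (∀ (i : Fin m) → lookup a i ≤ toℕ i)
  × (∀ (h i : Fin m) → toℕ i ≡ suc (toℕ h) → lookup a i ≤ suc (lookup a h))

module _ {m : ℕ} (a : Vec ℕ m) where

  -- {j, i} is an edge, with j < i.  The condition i - aᵢ ≤ j is written
  -- without subtraction.
  Edge : Fin m → Fin m → Set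
  Edge j i = toℕ j < toℕ i × toℕ i ≤ toℕ j ℕ.+ lookup a i

  Adjacent : Fin m → Fin m → Set
  Adjacent i j = Edge i j ⊎ Edge j i

  Isolated : Fin m → Set
  Isolated i = ∀ j → ¬ Adjacent i j

  PeakEdge : Fin m → Fin m → Set
  PeakEdge i j =
      (i ≡ j × Isolated i)
    ⊎ ( Edge i j
      × (∀ j⁺ → toℕ j⁺ ≡ suc (toℕ j) → ¬ Adjacent i j⁺)
      × (∀ i⁻ → toℕ i ≡ suc (toℕ i⁻) → ¬ Adjacent i⁻ j))

  -- The peak-clique {i, …, j} of the peak-edge (i , j) contains v.  Distinct
  -- peak-edges have distinct peak-cliques, so peak-cliques can be counted
  -- through their peak-edges.
  InPeakClique : Fin m → Fin m × Fin m → Set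
  InPeakClique v (i , j) = PeakEdge i j × i Fin.≤ v × v Fin.≤ j

  IsAbelian : Set
  IsAbelian = ∀ (first last i : Fin m) → toℕ first ≡ 0 → suc (toℕ last) ≡ m →
    i ≢ first → i ≢ last → Adjacent i first ⊎ Adjacent i last

  edge? : ∀ j i → Dec (Edge j i)
  edge? j i = (toℕ j <? toℕ i) ×-dec (toℕ i ≤? toℕ j ℕ.+ lookup a i)

  adjacent? : ∀ i j → Dec (Adjacent i j)
  adjacent? i j = edge? i j ⊎-dec edge? j i

  isolated? : ∀ i → Dec (Isolated i)
  isolated? i = Fin.all? λ j → ¬? (adjacent? i j)

  peakEdge? : ∀ i j → Dec (PeakEdge i j)
  peakEdge? i j =
    ((i Fin.≟ j) ×-dec isolated? i)
    ⊎-dec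
    ( edge? i j
      ×-dec (Fin.all? λ j⁺ → (toℕ j⁺ ℕ.≟ suc (toℕ j)) →-dec ¬? (adjacent? i j⁺))
      ×-dec (Fin.all? λ i⁻ → (toℕ i ℕ.≟ suc (toℕ i⁻)) →-dec ¬? (adjacent? i⁻ j)))

  inPeakClique? : ∀ v → Decidable (InPeakClique v)
  inPeakClique? v (i , j) = peakEdge? i j ×-dec (i Fin.≤? v) ×-dec (v Fin.≤? j)

  isAbelian? : Dec IsAbelian
  isAbelian? = Fin.all? λ first → Fin.all? λ last → Fin.all? λ i →
    (toℕ first ℕ.≟ 0) →-dec ((suc (toℕ last) ℕ.≟ m) →-dec
    (¬? (i Fin.≟ first) →-dec (¬? (i Fin.≟ last) →-dec
    (adjacent? i first ⊎-dec adjacent? i last))))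

  peakNesting : Fin m → ℕ
  peakNesting v = List.length (List.filter (inPeakClique? v)
    (List.cartesianProduct (List.allFin m) (List.allFin m)))

  pnest : ℕ
  pnest = max 0 (List.map peakNesting (List.allFin m))

isAreaSequence? : ∀ {m} → Decidable (IsAreaSequence {m})
isAreaSequence? a =
  (Fin.all? λ i → lookup a i ≤? toℕ i)
  ×-dec
  (Fin.all? λ h → Fin.all? λ i →
    (toℕ i ℕ.≟ suc (toℕ h)) →-dec (lookup a i ≤? suc (lookup a h)))

-- The set 𝒜(m), listed without repetition.  Since aᵢ < i ≤ m, it is enough to
-- search among the sequences with entries in {0, …, m-1}.
𝒜 : (m : ℕ) → List (Vec ℕ m)
𝒜 m = List.filter (λ a → isAreaSequence? a ×-dec isAbelian? a)
        (words (List.upTo m) m)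

Pnest : ℕ → Poly
Pnest m = sumₚ (List.map (λ a → X ^ₚ pnest a) (𝒜 m))

------------------------------------------------------------------------
-- Dyck paths

data Step : Set where
  N E : Step

_≟ₛ_ : DecidableEquality Step
N ≟ₛ N = yes refl
N ≟ₛ E = no λ ()
E ≟ₛ N = no λ ()
E ≟ₛ E = yes refl

Path : Set
Path = List Step

#[_] : Step → Path → ℕ
#[ s ] P = List.length (List.filter (s ≟ₛ_) P)

IsDyckPath : ℕ → Path → Set
IsDyckPath m P =
    #[ N ] P ≡ m
  × #[ E ] P ≡ m
  × All (λ Q → #[ E ] Q ≤ #[ N ] Q) (List.inits P)

-- The i-th N step lies on the line x = i - 1 - aᵢ, so aᵢ = y - x if this step
-- starts at (x , y), where y = i - 1.  The truncated subtraction is exact on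
-- paths weakly above the diagonal.
areasFrom : (x y : ℕ) → Path → List ℕ
areasFrom x y []      = []
areasFrom x y (N ∷ P) = (y ∸ x) ∷ areasFrom x (suc y) P
areasFrom x y (E ∷ P) = areasFrom (suc x) y P

areaSequence : (P : Path) → Vec ℕ (List.length (areasFrom 0 0 P))
areaSequence P = Vec.fromList (areasFrom 0 0 P)

IsAbelianDyckPath : ℕ → Path → Set
IsAbelianDyckPath m P = IsDyckPath m P × IsAbelian (areaSequence P)

-- The pair (k , L) as data; a path from (0,k) to (k,m) has exactly m steps.
Pair : ℕ → Set
Pair m = ℕ × Vec Step m

-- NᵏLEᵐ⁻ᵏ
toPath : ∀ {m} → Pair m → Path
toPath {m} (k , L) =
  List.replicate k N ++ Vec.toList L ++ List.replicate (m ∸ k) E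

IsPair : ∀ {m} → Pair m → Set
IsPair {m} (k , L) =
    (1 ≤ k × k ≤ m)
  × #[ E ] (Vec.toList L) ≡ k
  × k ℕ.+ #[ N ] (Vec.toList L) ≡ m
  × List.head (Vec.toList L) ≡ just E

-- With j : Fin n standing for toℕ j + 1 in [n], dropping 2 · toℕ j letters of
-- the augmented word LN leaves the factor S₂ⱼ₋₁S₂ⱼS₂ⱼ₊₁ in front.
factor : ∀ {n} → Vec Step (2 ℕ.* n) → Fin n → Path
factor L j = List.take 3 (List.drop (2 ℕ.* toℕ j) (Vec.toList L ++ N ∷ []))

AvoidsENEandNEN : ∀ {n} → Vec Step (2 ℕ.* n) → Set
AvoidsENEandNEN {n} L = ¬ (∃[ j ]
  (factor {n} L j ≡ E ∷ N ∷ E ∷ [] ⊎ factor {n} L j ≡ N ∷ E ∷ N ∷ []))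

isAbelianDyckPath? : ∀ m → Decidable (IsAbelianDyckPath m)
isAbelianDyckPath? m P =
  ( (#[ N ] P ℕ.≟ m)
    ×-dec (#[ E ] P ℕ.≟ m)
    ×-dec All.all? (λ Q → #[ E ] Q ≤? #[ N ] Q) (List.inits P))
  ×-dec isAbelian? (areaSequence P)

isPair? : ∀ {m} → Decidable (IsPair {m})
isPair? {m} (k , L) =
  ((1 ≤? k) ×-dec (k ≤? m))
  ×-dec (#[ E ] (Vec.toList L) ℕ.≟ k)
  ×-dec (k ℕ.+ #[ N ] (Vec.toList L) ℕ.≟ m)
  ×-dec Maybe.≡-dec _≟ₛ_ (List.head (Vec.toList L)) (just E)

avoidsENEandNEN? : ∀ {n} → Decidable (AvoidsENEandNEN {n})
avoidsENEandNEN? {n} L = ¬? (Fin.any? λ j →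
  List.≡-dec _≟ₛ_ (factor {n} L j) (E ∷ N ∷ E ∷ [])
  ⊎-dec List.≡-dec _≟ₛ_ (factor {n} L j) (N ∷ E ∷ N ∷ []))

-- The Abelian Dyck paths (k , L) of semilength m, listed without repetition.
abelianDyckPaths : ∀ m → List (Pair m)
abelianDyckPaths m =
  List.filter (λ p → isPair? p ×-dec isAbelianDyckPath? m (toPath p))
    (List.cartesianProduct (List.map suc (List.upTo m)) (words (N ∷ E ∷ []) m))

-- The Abelian Dyck paths (k , L) of semilength 2n with peak-nesting r such
-- that L satisfies the avoidance condition.
avoidingPaths : (n r : ℕ) → List (Pair (2 ℕ.* n))
avoidingPaths n r =
  List.filter (λ p@(k , L) →
      (pnest (areaSequence (toPath p)) ℕ.≟ r) ×-dec avoidsENEandNEN? {n} L)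
    (abelianDyckPaths (2 ℕ.* n))

{-# OPTIONS --safe #-}

-- An Abelian Dyck path (k , L) is determined by the word w with L = Ew, where
-- k - 1 is the number of letters E of w.  Call x the column of an N step on
-- the line with abscissa x.  Peak-cliques correspond to the last N steps of
-- the occupied columns, vertex k attains the maximal nesting, and it lies in
-- exactly the peak-cliques of the columns below k.  Hence the peak-nesting is
-- one more than the number of factors NE of w, and C(2n, 2j + 1) of the words
-- of length 2n - 1 have j such factors.  The gamma expansion is the part of odd
-- degree in s = √t of (1 + s)²ⁿ = (2s + (1 + s²))ⁿ, expanded by the binomial
-- theorem.  The avoidance condition leaves, for each pair of consecutive odd
-- positions of LN, one choice for the letter in between if the two letters
-- agree and two if they differ; peak-nesting i + 1 means 2i + 1 differences
-- among n pairs.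
module Submission where

open import Defs
open import Data.Nat using (ℕ; zero; suc; _≤_; _<_; z≤n; s≤s; s≤s⁻¹; z<s; _∸_; _*_; _+_; _^_)
open import Data.Nat.DivMod using (_/_; _%_; m%n<n; m≡m%n+[m/n]*n)
open import Data.Nat.Combinatorics using (_C_; nCk+nC[k+1]≡[n+1]C[k+1]; k>n⇒nCk≡0; nCk≡nC[n∸k]; nC1≡n)
import Data.Nat.Properties as ℕ
open import Data.Nat.Tactic.RingSolver using (solve-∀)
import Data.Integer as ℤ
open import Data.Integer using (ℤ; +_; 0ℤ; -[1+_])
import Data.Integer.Properties as ℤ
open import Data.Fin using (Fin; zero; suc; toℕ; fromℕ<)
import Data.Fin as Fin
import Data.Fin.Properties as Fin
open import Data.List using (List; []; _∷_; length; map; filter; _++_; applyUpTo; upTo; allFin; tabulate; cartesianProduct; replicate)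
import Data.List as List
import Data.List.Properties as List
open import Data.List.Extrema.Nat using (max≈v⁺)
open import Data.List.Membership.Propositional using (_∈_; lose)
open import Data.List.Membership.Propositional.Properties
open import Data.List.Membership.Propositional.Properties.WithK using (unique∧set⇒bag)
open import Data.List.Relation.Binary.BagAndSetEquality using (∼bag⇒↭)
open import Data.List.Relation.Binary.Permutation.Propositional using (_↭_)
open import Data.List.Relation.Binary.Permutation.Propositional.Properties using (↭-length; filter-↭)
open import Data.List.Relation.Unary.All as All using (All; []; _∷_)
import Data.List.Relation.Unary.All.Properties as All
open import Data.List.Relation.Unary.AllPairs using (AllPairs; []; _∷_)
open import Data.List.Relation.Unary.Any using (here; there)
open import Data.List.Relation.Unary.Unique.Propositional using (Unique)
import Data.List.Relation.Unary.Unique.Propositional.Properties as Unique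
import Data.Maybe.Properties as Maybe
open import Data.Vec using (Vec; toList; lookup)
import Data.Vec as Vec
import Data.Vec.Properties as Vec
open import Data.Unit using (⊤; tt)
open import Data.Empty using (⊥)
open import Data.Product using (_×_; _,_; ∃-syntax; proj₁; proj₂)
open import Data.Sum using (_⊎_; inj₁; inj₂)
open import Function using (_∘_; id; mk⇔)
open import Relation.Nullary using (Dec; ¬_; yes; no; contradiction)
open import Relation.Nullary.Decidable using (_×-dec_; _→-dec_)
open import Relation.Unary using (Decidable; _≐_)
open import Relation.Binary.PropositionalEquality using (_≡_; _≢_; refl; sym; trans; cong; cong₂; subst; module ≡-Reasoning)

open ≡-Reasoning

-- Coefficients of polynomials

-- Both halves of the statement have one combinatorial source. In the augmented word LN = EwN, mark
-- each of the 2n places between neighbouring letters at which the letter changes. The ends E and N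
-- differ, so the number of marks is odd, and 2j + 1 marks mean j factors NE; this is why the odd
-- part of (1 + s)²ⁿ appears. Now group the places into n consecutive pairs, one for each triple of
-- the avoidance condition. A pair contributes 2s if it has one mark and 1 + s² if it has none or
-- two, and the pairs with two marks are exactly the factors ENE and NEN. Expanding over the set of
-- pairs with one mark is the gamma expansion; the avoidance condition keeps only the 1 of every 1 +
-- s², so that what remains is counted by the gamma coefficients. The two counts are carried out
-- separately, by recursions that end in Pascal's rule, and they meet in `gammaCoeff`.

coeff-⊕ : ∀ p q i → coeff (p ⊕ q) i ≡ coeff p i ℤ.+ coeff q i
coeff-⊕ []      q       i       = sym (ℤ.+-identityˡ _)
coeff-⊕ (c ∷ p) []      i       = sym (ℤ.+-identityʳ _)
coeff-⊕ (c ∷ p) (d ∷ q) zero    = refl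
coeff-⊕ (c ∷ p) (d ∷ q) (suc i) = coeff-⊕ p q i

coeff-map : ∀ f → f 0ℤ ≡ 0ℤ → ∀ p i → coeff (map f p) i ≡ f (coeff p i)
coeff-map f f0 []      i       = sym f0
coeff-map f f0 (c ∷ p) zero    = refl
coeff-map f f0 (c ∷ p) (suc i) = coeff-map f f0 p i

coeff-⊗-zero : ∀ c p q → coeff ((c ∷ p) ⊗ q) 0 ≡ c ℤ.* coeff q 0
coeff-⊗-zero c p q = begin
  coeff ((c ∷ p) ⊗ q) 0                  ≡⟨ coeff-⊕ (map (c ℤ.*_) q) (0ℤ ∷ (p ⊗ q)) 0 ⟩
  coeff (map (c ℤ.*_) q) 0 ℤ.+ 0ℤ        ≡⟨ ℤ.+-identityʳ _ ⟩
  coeff (map (c ℤ.*_) q) 0               ≡⟨ coeff-map (c ℤ.*_) (ℤ.*-zeroʳ c) q 0 ⟩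
  c ℤ.* coeff q 0                        ∎

coeff-⊗-suc : ∀ c p q i →
  coeff ((c ∷ p) ⊗ q) (suc i) ≡ c ℤ.* coeff q (suc i) ℤ.+ coeff (p ⊗ q) i
coeff-⊗-suc c p q i = begin
  coeff ((c ∷ p) ⊗ q) (suc i)
    ≡⟨ coeff-⊕ (map (c ℤ.*_) q) (0ℤ ∷ (p ⊗ q)) (suc i) ⟩
  coeff (map (c ℤ.*_) q) (suc i) ℤ.+ coeff (p ⊗ q) i
    ≡⟨ cong (ℤ._+ _) (coeff-map (c ℤ.*_) (ℤ.*-zeroʳ c) q (suc i)) ⟩
  c ℤ.* coeff q (suc i) ℤ.+ coeff (p ⊗ q) i ∎

-- A representative of the zero polynomial can be a nonempty list of zeros, so this does not reduce
-- to the first clause of `_⊗_`. It settles the cases of `⊗-congˡ` in which one list ends before the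
-- other.
⊗-zeroˡ : ∀ p → p ≈ [] → ∀ q → p ⊗ q ≈ []
⊗-zeroˡ []      p≈0 q i       = refl
⊗-zeroˡ (c ∷ p) p≈0 q zero    = begin
  coeff ((c ∷ p) ⊗ q) 0 ≡⟨ coeff-⊗-zero c p q ⟩
  c ℤ.* coeff q 0       ≡⟨ cong (ℤ._* coeff q 0) (p≈0 0) ⟩
  0ℤ ∎
⊗-zeroˡ (c ∷ p) p≈0 q (suc i) = begin
  coeff ((c ∷ p) ⊗ q) (suc i)               ≡⟨ coeff-⊗-suc c p q i ⟩
  c ℤ.* coeff q (suc i) ℤ.+ coeff (p ⊗ q) i ≡⟨ cong₂ ℤ._+_ (cong (ℤ._* coeff q (suc i)) (p≈0 0)) (⊗-zeroˡ p (p≈0 ∘ suc) q i) ⟩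
  0ℤ ∎

⊗-congˡ : ∀ p p′ → p ≈ p′ → ∀ q → p ⊗ q ≈ p′ ⊗ q
⊗-congˡ []      p′       p≈p′ q i       = sym (⊗-zeroˡ p′ (sym ∘ p≈p′) q i)
⊗-congˡ (c ∷ p) []       p≈p′ q i       = ⊗-zeroˡ (c ∷ p) p≈p′ q i
⊗-congˡ (c ∷ p) (d ∷ p′) p≈p′ q zero    = begin
  coeff ((c ∷ p) ⊗ q) 0  ≡⟨ coeff-⊗-zero c p q ⟩
  c ℤ.* coeff q 0        ≡⟨ cong (ℤ._* coeff q 0) (p≈p′ 0) ⟩
  d ℤ.* coeff q 0        ≡⟨ coeff-⊗-zero d p′ q ⟨
  coeff ((d ∷ p′) ⊗ q) 0 ∎
⊗-congˡ (c ∷ p) (d ∷ p′) p≈p′ q (suc i) = begin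
  coeff ((c ∷ p) ⊗ q) (suc i)                ≡⟨ coeff-⊗-suc c p q i ⟩
  c ℤ.* coeff q (suc i) ℤ.+ coeff (p ⊗ q) i
    ≡⟨ cong₂ ℤ._+_ (cong (ℤ._* coeff q (suc i)) (p≈p′ 0)) (⊗-congˡ p p′ (p≈p′ ∘ suc) q i) ⟩
  d ℤ.* coeff q (suc i) ℤ.+ coeff (p′ ⊗ q) i ≡⟨ coeff-⊗-suc d p′ q i ⟨
  coeff ((d ∷ p′) ⊗ q) (suc i)               ∎

coeff-const-⊗ : ∀ c q i → coeff (const c ⊗ q) i ≡ c ℤ.* coeff q i
coeff-const-⊗ c q zero    = coeff-⊗-zero c [] q
coeff-const-⊗ c q (suc i) = trans (coeff-⊗-suc c [] q i) (ℤ.+-identityʳ _)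

coeff-linear-⊗ : ∀ a b q i →
  coeff ((a ∷ b ∷ []) ⊗ q) (suc i) ≡ a ℤ.* coeff q (suc i) ℤ.+ b ℤ.* coeff q i
coeff-linear-⊗ a b q i =
  trans (coeff-⊗-suc a (b ∷ []) q i) (cong (λ x → (a ℤ.* coeff q (suc i)) ℤ.+ x) (coeff-const-⊗ b q i))

coeff-X⊗-zero : ∀ q → coeff (X ⊗ q) 0 ≡ 0ℤ
coeff-X⊗-zero q = coeff-⊗-zero 0ℤ (ℤ.1ℤ ∷ []) q

coeff-X⊗-suc : ∀ q i → coeff (X ⊗ q) (suc i) ≡ coeff q i
coeff-X⊗-suc q i = begin
  coeff (X ⊗ q) (suc i)              ≡⟨ coeff-linear-⊗ 0ℤ ℤ.1ℤ q i ⟩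
  0ℤ ℤ.+ ℤ.1ℤ ℤ.* coeff q i          ≡⟨ ℤ.+-identityˡ _ ⟩
  ℤ.1ℤ ℤ.* coeff q i                 ≡⟨ ℤ.*-identityˡ _ ⟩
  coeff q i                          ∎

-- Multiplication of a coefficient sequence by tⁱ. The type and the filler are parameters so that
-- the same shift serves ℕ and ℤ, with `delay-natural` moving the cast `+_` across it.
delay : {A : Set} → A → ℕ → (ℕ → A) → ℕ → A
delay z zero    f j       = f j
delay z (suc i) f zero    = z
delay z (suc i) f (suc j) = delay z i f j

delay-natural : {A B : Set} (g : A → B) (z : A) → ∀ i f f′ → (∀ j → f′ j ≡ g (f j)) →
  ∀ j → delay (g z) i f′ j ≡ g (delay z i f j)
delay-natural g z zero    f f′ eq j       = eq j
delay-natural g z (suc i) f f′ eq zero    = refl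
delay-natural g z (suc i) f f′ eq (suc j) = delay-natural g z i f f′ eq j

-- A normal form of `const c ⊗ X ^ₚ i`, whose list may carry trailing zeros. Multiplication by the
-- normal form is visibly a shift.
monomial : ℤ → ℕ → Poly
monomial c zero    = const c
monomial c (suc i) = 0ℤ ∷ monomial c i

coeff-monomial-⊗ : ∀ c i q j → coeff (monomial c i ⊗ q) j ≡ delay 0ℤ i (λ l → c ℤ.* coeff q l) j
coeff-monomial-⊗ c zero    q j       = coeff-const-⊗ c q j
coeff-monomial-⊗ c (suc i) q zero    = coeff-⊗-zero 0ℤ (monomial c i) q
coeff-monomial-⊗ c (suc i) q (suc j) = begin
  coeff (monomial c (suc i) ⊗ q) (suc j)   ≡⟨ coeff-⊗-suc 0ℤ (monomial c i) q j ⟩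
  0ℤ ℤ.+ coeff (monomial c i ⊗ q) j        ≡⟨ ℤ.+-identityˡ _ ⟩
  coeff (monomial c i ⊗ q) j               ≡⟨ coeff-monomial-⊗ c i q j ⟩
  delay 0ℤ i (λ l → c ℤ.* coeff q l) j     ∎

const-⊗-X^ : ∀ c i → const c ⊗ X ^ₚ i ≈ monomial c i
const-⊗-X^ c zero    j       = trans (coeff-const-⊗ c (const ℤ.1ℤ) j) (lemma j)
  where
  lemma : ∀ j → c ℤ.* coeff (const ℤ.1ℤ) j ≡ coeff (const c) j
  lemma zero    = ℤ.*-identityʳ c
  lemma (suc j) = ℤ.*-zeroʳ c
const-⊗-X^ c (suc i) zero    = begin
  coeff (const c ⊗ X ^ₚ suc i) 0 ≡⟨ coeff-const-⊗ c (X ^ₚ suc i) 0 ⟩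
  c ℤ.* coeff (X ^ₚ suc i) 0     ≡⟨ cong (c ℤ.*_) (coeff-X⊗-zero (X ^ₚ i)) ⟩
  c ℤ.* 0ℤ                       ≡⟨ ℤ.*-zeroʳ c ⟩
  0ℤ                             ∎
const-⊗-X^ c (suc i) (suc j) = begin
  coeff (const c ⊗ X ^ₚ suc i) (suc j) ≡⟨ coeff-const-⊗ c (X ^ₚ suc i) (suc j) ⟩
  c ℤ.* coeff (X ^ₚ suc i) (suc j)     ≡⟨ cong (c ℤ.*_) (coeff-X⊗-suc (X ^ₚ i) j) ⟩
  c ℤ.* coeff (X ^ₚ i) j               ≡⟨ coeff-const-⊗ c (X ^ₚ i) j ⟨
  coeff (const c ⊗ X ^ₚ i) j           ≡⟨ const-⊗-X^ c i j ⟩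
  coeff (monomial c i) j               ∎

coeff-monomial : ∀ c i j → coeff (monomial c i) j ≡ delay 0ℤ i (coeff (const c)) j
coeff-monomial c zero    j       = refl
coeff-monomial c (suc i) zero    = refl
coeff-monomial c (suc i) (suc j) = coeff-monomial c i j

0C[1+k]≡0 : ∀ k → 0 C suc k ≡ 0
0C[1+k]≡0 k = k>n⇒nCk≡0 {0} {suc k} z<s

pascal : ∀ n k → suc n C suc k ≡ n C suc k + n C k
pascal n k = trans (sym (nCk+nC[k+1]≡[n+1]C[k+1] n k)) (ℕ.+-comm (n C k) _)

-- The coefficient b is general because b = 1 serves the gamma expansion, while b = 2 and b = -2
-- serve the form in √t.
coeff-binomial : ∀ b n j → coeff ((+ 1 ∷ b ∷ []) ^ₚ n) j ≡ b ℤ.^ j ℤ.* + (n C j)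
coeff-binomial b zero    zero    = refl
coeff-binomial b zero    (suc j) = sym (trans (cong (λ x → b ℤ.^ suc j ℤ.* + x) (0C[1+k]≡0 j)) (ℤ.*-zeroʳ (b ℤ.^ suc j)))
coeff-binomial b (suc n) zero    = begin
  coeff ((+ 1 ∷ b ∷ []) ^ₚ suc n) 0                  ≡⟨ coeff-⊗-zero (+ 1) (b ∷ []) ((+ 1 ∷ b ∷ []) ^ₚ n) ⟩
  + 1 ℤ.* coeff ((+ 1 ∷ b ∷ []) ^ₚ n) 0              ≡⟨ cong (+ 1 ℤ.*_) (coeff-binomial b n 0) ⟩
  + 1                                                 ∎
coeff-binomial b (suc n) (suc j) = begin
  coeff ((+ 1 ∷ b ∷ []) ^ₚ suc n) (suc j)
    ≡⟨ coeff-linear-⊗ (+ 1) b ((+ 1 ∷ b ∷ []) ^ₚ n) j ⟩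
  + 1 ℤ.* coeff ((+ 1 ∷ b ∷ []) ^ₚ n) (suc j) ℤ.+ b ℤ.* coeff ((+ 1 ∷ b ∷ []) ^ₚ n) j
    ≡⟨ cong₂ ℤ._+_ (trans (ℤ.*-identityˡ _) (coeff-binomial b n (suc j))) (cong (b ℤ.*_) (coeff-binomial b n j)) ⟩
  b ℤ.^ suc j ℤ.* + (n C suc j) ℤ.+ b ℤ.* (b ℤ.^ j ℤ.* + (n C j))
    ≡⟨ cong (λ x → (b ℤ.^ suc j ℤ.* + (n C suc j)) ℤ.+ x) (ℤ.*-assoc b (b ℤ.^ j) (+ (n C j))) ⟨
  b ℤ.^ suc j ℤ.* + (n C suc j) ℤ.+ b ℤ.^ suc j ℤ.* + (n C j)
    ≡⟨ ℤ.*-distribˡ-+ (b ℤ.^ suc j) (+ (n C suc j)) (+ (n C j)) ⟨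
  b ℤ.^ suc j ℤ.* + (n C suc j + n C j)
    ≡⟨ cong (λ x → b ℤ.^ suc j ℤ.* + x) (pascal n j) ⟨
  b ℤ.^ suc j ℤ.* + (suc n C suc j) ∎

sum< : ℕ → (ℕ → ℕ) → ℕ
sum< zero    f = 0
sum< (suc n) f = f 0 + sum< n (f ∘ suc)

sum<-cong : ∀ n {f g : ℕ → ℕ} → (∀ i → i < n → f i ≡ g i) → sum< n f ≡ sum< n g
sum<-cong zero    eq = refl
sum<-cong (suc n) eq = cong₂ _+_ (eq 0 z<s) (sum<-cong n (λ i i<n → eq (suc i) (s≤s i<n)))

sum<-suc : ∀ n f → sum< (suc n) f ≡ sum< n f + f n
sum<-suc zero    f = ℕ.+-comm (f 0) 0
sum<-suc (suc n) f = trans (cong (λ x → f 0 + x) (sum<-suc n (f ∘ suc))) (sym (ℕ.+-assoc (f 0) _ _))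

sum<-+ : ∀ n f g → sum< n (λ i → f i + g i) ≡ sum< n f + sum< n g
sum<-+ zero    f g = refl
sum<-+ (suc n) f g = trans (cong (λ x → f 0 + g 0 + x) (sum<-+ n (f ∘ suc) (g ∘ suc))) (lemma (f 0) (g 0) _ _)
  where
  lemma : ∀ a b c d → a + b + (c + d) ≡ a + c + (b + d)
  lemma = solve-∀

sum<-odd : ∀ h f → (∀ i → f (i * 2) ≡ 0) → sum< (h * 2) f ≡ sum< h (λ i → f (suc (i * 2)))
sum<-odd zero    f even≡0 = refl
sum<-odd (suc h) f even≡0 = begin
  f 0 + (f 1 + sum< (h * 2) (λ i → f (suc (suc i)))) ≡⟨ cong (_+ (f 1 + sum< (h * 2) (λ i → f (suc (suc i))))) (even≡0 0) ⟩
  f 1 + sum< (h * 2) (λ i → f (suc (suc i)))         ≡⟨ cong (λ x → f 1 + x) (sum<-odd h (λ i → f (suc (suc i))) (even≡0 ∘ suc)) ⟩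
  f 1 + sum< h (λ i → f (suc (suc i * 2)))   ∎

coeff-∑≤ : ∀ M f j g → (∀ i → coeff (f i) j ≡ + g i) → coeff (∑≤ M f) j ≡ + sum< (suc M) g
coeff-∑≤ M f j g eq = trans (cong (λ l → coeff (sumₚ l) j) (List.map-upTo f (suc M))) (go (suc M) f g eq)
  where
  go : ∀ n f g → (∀ i → coeff (f i) j ≡ + g i) → coeff (sumₚ (applyUpTo f n)) j ≡ + sum< n g
  go zero    f g eq = refl
  go (suc n) f g eq = begin
    coeff (f 0 ⊕ sumₚ (applyUpTo (f ∘ suc) n)) j ≡⟨ coeff-⊕ (f 0) _ j ⟩
    coeff (f 0) j ℤ.+ coeff (sumₚ (applyUpTo (f ∘ suc) n)) j ≡⟨ cong₂ ℤ._+_ (eq 0) (go n (f ∘ suc) (g ∘ suc) (eq ∘ suc)) ⟩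
    + (g 0 + sum< n (g ∘ suc)) ∎

coeff-X²⊗ : ∀ q j → coeff (X ^ₚ 2 ⊗ q) j ≡ delay 0ℤ 2 (λ l → + 1 ℤ.* coeff q l) j
coeff-X²⊗ q j = trans (⊗-congˡ (X ^ₚ 2) (monomial (+ 1) 2) X²≈ q j) (coeff-monomial-⊗ (+ 1) 2 q j)
  where
  X²≈ : X ^ₚ 2 ≈ monomial (+ 1) 2
  X²≈ 0 = refl
  X²≈ 1 = refl
  X²≈ 2 = refl
  X²≈ (suc (suc (suc j))) = refl

coeff-∘X² : ∀ p i → coeff (p ∘ₚ (X ^ₚ 2)) (i * 2) ≡ coeff p i
                  × coeff (p ∘ₚ (X ^ₚ 2)) (suc (i * 2)) ≡ 0ℤ
coeff-∘X² []      i       = refl , refl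
coeff-∘X² (c ∷ p) zero    = trans (horner 0) (ℤ.+-identityʳ c) , horner 1
  where
  q = p ∘ₚ (X ^ₚ 2)
  horner : ∀ j → coeff ((c ∷ p) ∘ₚ (X ^ₚ 2)) j ≡ coeff (const c) j ℤ.+ delay 0ℤ 2 (λ l → + 1 ℤ.* coeff q l) j
  horner j = trans (coeff-⊕ (const c) (X ^ₚ 2 ⊗ q) j) (cong (λ x → coeff (const c) j ℤ.+ x) (coeff-X²⊗ q j))
coeff-∘X² (c ∷ p) (suc i) =
  let (even , odd) = coeff-∘X² p i in trans (shift (i * 2)) even , trans (shift (suc (i * 2))) odd
  where
  q = p ∘ₚ (X ^ₚ 2)
  shift : ∀ j → coeff ((c ∷ p) ∘ₚ (X ^ₚ 2)) (suc (suc j)) ≡ coeff q j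
  shift j = begin
    coeff (const c ⊕ X ^ₚ 2 ⊗ q) (suc (suc j))   ≡⟨ coeff-⊕ (const c) (X ^ₚ 2 ⊗ q) (suc (suc j)) ⟩
    0ℤ ℤ.+ coeff (X ^ₚ 2 ⊗ q) (suc (suc j))      ≡⟨ ℤ.+-identityˡ _ ⟩
    coeff (X ^ₚ 2 ⊗ q) (suc (suc j))             ≡⟨ coeff-X²⊗ q (suc (suc j)) ⟩
    + 1 ℤ.* coeff q j                            ≡⟨ ℤ.*-identityˡ _ ⟩
    coeff q j                                    ∎

-- Binomial identities

-- The expansion of (x + y)ⁿ one factor at a time, with `g c d` in place of xᶜyᵈ. It mentions
-- neither binomial coefficients nor `n ∸ c`, which makes `binomialSum-term` a plain induction;
-- `binomialSum≡` restores the usual form afterwards.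
binomialSum : ℕ → (ℕ → ℕ → ℕ) → ℕ
binomialSum zero    g = g 0 0
binomialSum (suc n) g = binomialSum n (λ c d → g c (suc d)) + binomialSum n (λ c d → g (suc c) d)

binomialSum-cong : ∀ n {f g : ℕ → ℕ → ℕ} → (∀ c d → f c d ≡ g c d) → binomialSum n f ≡ binomialSum n g
binomialSum-cong zero    eq = eq 0 0
binomialSum-cong (suc n) eq = cong₂ _+_ (binomialSum-cong n (λ c d → eq c (suc d))) (binomialSum-cong n (λ c d → eq (suc c) d))

binomialSum-+ : ∀ n f g → binomialSum n (λ c d → f c d + g c d) ≡ binomialSum n f + binomialSum n g
binomialSum-+ zero    f g = refl
binomialSum-+ (suc n) f g =
  trans (cong₂ _+_ (binomialSum-+ n _ _) (binomialSum-+ n _ _))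
        (lemma (binomialSum n (λ c d → f c (suc d))) (binomialSum n (λ c d → g c (suc d))) _ _)
  where
  lemma : ∀ a b c d → a + b + (c + d) ≡ a + c + (b + d)
  lemma = solve-∀

binomialSum-zero : ∀ n → binomialSum n (λ _ _ → 0) ≡ 0
binomialSum-zero zero    = refl
binomialSum-zero (suc n) = cong₂ _+_ (binomialSum-zero n) (binomialSum-zero n)

binomialSum≡ : ∀ n g → binomialSum n g ≡ sum< (suc n) (λ c → (n C c) * g c (n ∸ c))
binomialSum≡ zero    g = sym (trans (ℕ.+-identityʳ _) (ℕ.*-identityˡ _))
binomialSum≡ (suc n) g = begin
  binomialSum n (λ c d → g c (suc d)) + binomialSum n (λ c d → g (suc c) d)
    ≡⟨ cong₂ _+_ (binomialSum≡ n _) (binomialSum≡ n _) ⟩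
  sum< (suc n) (λ c → (n C c) * g c (suc (n ∸ c))) + sum< (suc n) (λ c → (n C c) * g (suc c) (n ∸ c))
    ≡⟨ cong (_+ sum< (suc n) (λ c → (n C c) * g (suc c) (n ∸ c))) first ⟩
  (n C 0) * g 0 (suc n) + sum< (suc n) (λ c → (n C suc c) * g (suc c) (n ∸ c)) + sum< (suc n) (λ c → (n C c) * g (suc c) (n ∸ c))
    ≡⟨ ℕ.+-assoc ((n C 0) * g 0 (suc n)) _ _ ⟩
  (n C 0) * g 0 (suc n) + (sum< (suc n) (λ c → (n C suc c) * g (suc c) (n ∸ c)) + sum< (suc n) (λ c → (n C c) * g (suc c) (n ∸ c)))
    ≡⟨ cong (λ x → (n C 0) * g 0 (suc n) + x) (sum<-+ (suc n) (λ c → (n C suc c) * g (suc c) (n ∸ c)) (λ c → (n C c) * g (suc c) (n ∸ c))) ⟨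
  (n C 0) * g 0 (suc n) + sum< (suc n) (λ c → (n C suc c) * g (suc c) (n ∸ c) + (n C c) * g (suc c) (n ∸ c))
    ≡⟨ cong (λ x → (n C 0) * g 0 (suc n) + x) (sum<-cong (suc n) (λ c _ →
         trans (cong (_* g (suc c) (n ∸ c)) (pascal n c)) (ℕ.*-distribʳ-+ (g (suc c) (n ∸ c)) (n C suc c) (n C c)))) ⟨
  (suc n C 0) * g 0 (suc n) + sum< (suc n) (λ c → (suc n C suc c) * g (suc c) (n ∸ c)) ∎
  where
  -- After its index is shifted, the first sum has one term fewer than the second. A zero term at c
  -- = n gives both the same range, so that Pascal's rule can be applied term by term.
  last≡0 : (n C suc n) * g (suc n) (n ∸ n) ≡ 0
  last≡0 = cong (_* g (suc n) (n ∸ n)) (k>n⇒nCk≡0 (ℕ.n<1+n n))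
  first : sum< (suc n) (λ c → (n C c) * g c (suc (n ∸ c)))
        ≡ (n C 0) * g 0 (suc n) + sum< (suc n) (λ c → (n C suc c) * g (suc c) (n ∸ c))
  first = cong (λ x → (n C 0) * g 0 (suc n) + x) (begin
    sum< n (λ c → (n C suc c) * g (suc c) (suc (n ∸ suc c)))
      ≡⟨ sum<-cong n (λ c c<n → cong (λ d → (n C suc c) * g (suc c) d) (sym (ℕ.+-∸-assoc 1 c<n))) ⟩
    sum< n (λ c → (n C suc c) * g (suc c) (n ∸ c))
      ≡⟨ ℕ.+-identityʳ _ ⟨
    sum< n (λ c → (n C suc c) * g (suc c) (n ∸ c)) + 0
      ≡⟨ cong (λ x → (sum< n (λ c → (n C suc c) * g (suc c) (n ∸ c))) + x) last≡0 ⟨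
    sum< n (λ c → (n C suc c) * g (suc c) (n ∸ c)) + (n C suc n) * g (suc n) (n ∸ n)
      ≡⟨ sum<-suc n (λ c → (n C suc c) * g (suc c) (n ∸ c)) ⟨
    sum< (suc n) (λ c → (n C suc c) * g (suc c) (n ∸ c)) ∎)


-- spread f lists the coefficients of F(t²) when f lists those of F(t).
spread : (ℕ → ℕ) → ℕ → ℕ
spread f zero          = f 0
spread f (suc zero)    = 0
spread f (suc (suc r)) = spread (f ∘ suc) r

spread-cong : ∀ {f g : ℕ → ℕ} → (∀ i → f i ≡ g i) → ∀ r → spread f r ≡ spread g r
spread-cong eq zero          = eq 0
spread-cong eq (suc zero)    = refl
spread-cong eq (suc (suc r)) = spread-cong (eq ∘ suc) r

spread-+ : ∀ f g r → spread (λ i → f i + g i) r ≡ spread f r + spread g r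
spread-+ f g zero          = refl
spread-+ f g (suc zero)    = refl
spread-+ f g (suc (suc r)) = spread-+ (f ∘ suc) (g ∘ suc) r

spread-even : ∀ f i → spread f (i * 2) ≡ f i
spread-even f zero    = refl
spread-even f (suc i) = spread-even (f ∘ suc) i

spread-odd : ∀ f i → spread f (suc (i * 2)) ≡ 0
spread-odd f zero    = refl
spread-odd f (suc i) = spread-odd (f ∘ suc) i

-- Coefficientwise, (1 + t²)ᵈ⁺¹ = (1 + t²)ᵈ + t²(1 + t²)ᵈ.
spread-pascal : ∀ d r → spread (suc d C_) r ≡ spread (d C_) r + delay 0 2 (spread (d C_)) r
spread-pascal d zero          = refl
spread-pascal d (suc zero)    = refl
spread-pascal d (suc (suc r)) = trans (spread-cong (pascal d) r) (spread-+ _ _ r)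

delay-+ : ∀ k f g r → delay 0 k (λ i → f i + g i) r ≡ delay 0 k f r + delay 0 k g r
delay-+ zero    f g r       = refl
delay-+ (suc k) f g zero    = refl
delay-+ (suc k) f g (suc r) = delay-+ k f g r

delay-cong : ∀ k {f g : ℕ → ℕ} → (∀ i → f i ≡ g i) → ∀ r → delay 0 k f r ≡ delay 0 k g r
delay-cong zero    eq r       = eq r
delay-cong (suc k) eq zero    = refl
delay-cong (suc k) eq (suc r) = delay-cong k eq r

delay-* : ∀ a k f r → delay 0 k (λ i → a * f i) r ≡ a * delay 0 k f r
delay-* a zero    f r       = refl
delay-* a (suc k) f zero    = sym (ℕ.*-zeroʳ a)
delay-* a (suc k) f (suc r) = delay-* a k f r

-- The coefficient of tʳ in (2t)ᶜ(1 + t²)ᵈ.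
term : ℕ → ℕ → ℕ → ℕ
term c d r = 2 ^ c * delay 0 c (spread (d C_)) r

-- Multiplication by 1 + t². The auxiliary `swap` lets the shift by two places pass the c places
-- that come from (2t)ᶜ.
term-sucʳ : ∀ c d r → term c (suc d) r ≡ term c d r + delay 0 2 (term c d) r
term-sucʳ c d r = begin
  2 ^ c * delay 0 c (spread (suc d C_)) r
    ≡⟨ cong (2 ^ c *_) (delay-cong c (spread-pascal d) r) ⟩
  2 ^ c * delay 0 c (λ r → s r + delay 0 2 s r) r
    ≡⟨ cong (2 ^ c *_) (delay-+ c s (delay 0 2 s) r) ⟩
  2 ^ c * (delay 0 c s r + delay 0 c (delay 0 2 s) r)
    ≡⟨ ℕ.*-distribˡ-+ (2 ^ c) _ _ ⟩
  term c d r + 2 ^ c * delay 0 c (delay 0 2 s) r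
    ≡⟨ cong (λ x → term c d r + 2 ^ c * x) (swap c s r) ⟩
  term c d r + 2 ^ c * delay 0 2 (delay 0 c s) r
    ≡⟨ cong (λ x → term c d r + x) (delay-* (2 ^ c) 2 (delay 0 c s) r) ⟨
  term c d r + delay 0 2 (term c d) r ∎
  where
  s = spread (d C_)
  step : ∀ k f r → delay 0 (suc k) f r ≡ delay 0 1 (delay 0 k f) r
  step k f zero    = refl
  step k f (suc r) = refl
  swap : ∀ c f r → delay 0 c (delay 0 2 f) r ≡ delay 0 2 (delay 0 c f) r
  swap zero    f r             = refl
  swap (suc c) f zero          = refl
  swap (suc c) f (suc zero)    = swap c f zero
  swap (suc c) f (suc (suc r)) = trans (swap c f (suc r)) (sym (step c f r))

-- Multiplication by 2t, with the factor 2 written as a sum to suit `binomialSum-+`.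
term-sucˡ : ∀ c d r → term (suc c) d r ≡ delay 0 1 (term c d) r + delay 0 1 (term c d) r
term-sucˡ c d zero    = ℕ.*-zeroʳ (2 ^ suc c)
term-sucˡ c d (suc r) = lemma (2 ^ c) (delay 0 c (spread (d C_)) r)
  where
  lemma : ∀ a b → 2 * a * b ≡ a * b + a * b
  lemma = solve-∀

binomialSum-delay : ∀ n k (h : ℕ → ℕ → ℕ → ℕ) r →
  binomialSum n (λ c d → delay 0 k (h c d) r) ≡ delay 0 k (λ r → binomialSum n (λ c d → h c d r)) r
binomialSum-delay n zero    h r       = refl
binomialSum-delay n (suc k) h zero    = binomialSum-zero n
binomialSum-delay n (suc k) h (suc r) = binomialSum-delay n k h r

-- Coefficientwise, (1 + t)ᵐ⁺² = (1 + t² + 2t)(1 + t)ᵐ, grouped as the two recursions for `term`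
-- produce it.
[2+m]C : ∀ m r → suc (suc m) C r ≡ m C r + delay 0 2 (m C_) r + (delay 0 1 (m C_) r + delay 0 1 (m C_) r)
[2+m]C m zero          = refl
[2+m]C m (suc zero)    = begin
  suc (suc m) C 1             ≡⟨ pascal (suc m) 0 ⟩
  suc m C 1 + 1               ≡⟨ cong (_+ 1) (pascal m 0) ⟩
  m C 1 + 1 + 1               ≡⟨ lemma (m C 1) ⟩
  m C 1 + 0 + (1 + 1)         ∎
  where
  lemma : ∀ a → a + 1 + 1 ≡ a + 0 + (1 + 1)
  lemma = solve-∀
[2+m]C m (suc (suc r)) = begin
  suc (suc m) C suc (suc r)          ≡⟨ pascal (suc m) (suc r) ⟩
  suc m C suc (suc r) + suc m C suc r ≡⟨ cong₂ _+_ (pascal m (suc r)) (pascal m r) ⟩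
  m C suc (suc r) + m C suc r + (m C suc r + m C r) ≡⟨ lemma (m C suc (suc r)) (m C suc r) (m C r) ⟩
  m C suc (suc r) + m C r + (m C suc r + m C suc r) ∎
  where
  lemma : ∀ a b c → a + b + (b + c) ≡ a + c + (b + b)
  lemma = solve-∀

-- This is (1 + t)²ⁿ = (2t + (1 + t²))ⁿ.
binomialSum-term : ∀ n r → binomialSum n (λ c d → term c d r) ≡ n * 2 C r
binomialSum-term zero    zero          = refl
binomialSum-term zero    (suc zero)    = refl
binomialSum-term zero    (suc (suc r)) = begin
  1 * spread (λ i → 0 C suc i) r ≡⟨ ℕ.*-identityˡ _ ⟩
  spread (λ i → 0 C suc i) r     ≡⟨ spread-cong 0C[1+k]≡0 r ⟩
  spread (λ i → 0) r             ≡⟨ spread-zero r ⟩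
  0                              ≡⟨ 0C[1+k]≡0 (suc r) ⟨
  0 C suc (suc r)                ∎
  where
  spread-zero : ∀ r → spread (λ _ → 0) r ≡ 0
  spread-zero zero          = refl
  spread-zero (suc zero)    = refl
  spread-zero (suc (suc r)) = spread-zero r
binomialSum-term (suc n) r = begin
  binomialSum n (λ c d → term c (suc d) r) + binomialSum n (λ c d → term (suc c) d r)
    ≡⟨ cong₂ _+_ (binomialSum-cong n (λ c d → term-sucʳ c d r)) (binomialSum-cong n (λ c d → term-sucˡ c d r)) ⟩
  binomialSum n (λ c d → term c d r + delay 0 2 (term c d) r)
    + binomialSum n (λ c d → delay 0 1 (term c d) r + delay 0 1 (term c d) r)
    ≡⟨ cong₂ _+_ (binomialSum-+ n _ _) (binomialSum-+ n _ _) ⟩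
  binomialSum n (λ c d → term c d r) + delayed 2 + (delayed 1 + delayed 1)
    ≡⟨ cong₂ _+_ (cong₂ _+_ (binomialSum-term n r) (delayed≡ 2)) (cong₂ _+_ (delayed≡ 1) (delayed≡ 1)) ⟩
  n * 2 C r + delay 0 2 (n * 2 C_) r + (delay 0 1 (n * 2 C_) r + delay 0 1 (n * 2 C_) r)
    ≡⟨ [2+m]C (n * 2) r ⟨
  suc n * 2 C r ∎
  where
  delayed : ℕ → ℕ
  delayed k = binomialSum n (λ c d → delay 0 k (term c d) r)
  delayed≡ : ∀ k → delayed k ≡ delay 0 k (n * 2 C_) r
  delayed≡ k = trans (binomialSum-delay n k term r) (delay-cong k (binomialSum-term n) r)

-- An even power of 2t times a power of 1 + t² is an even polynomial, hence has no coefficient in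
-- odd degree.
term-even : ∀ i d j → term (i * 2) d (suc (j * 2)) ≡ 0
term-even i d j = trans (cong (2 ^ (i * 2) *_) (lemma i j)) (ℕ.*-zeroʳ (2 ^ (i * 2)))
  where
  lemma : ∀ i j → delay 0 (i * 2) (spread (d C_)) (suc (j * 2)) ≡ 0
  lemma zero    j       = spread-odd (d C_) j
  lemma (suc i) zero    = refl
  lemma (suc i) (suc j) = lemma i j

-- Removing one factor t and then writing t for t² turns the odd polynomial (2t)²ⁱ⁺¹(1 + t²)ᵈ into
-- 2²ⁱ⁺¹tⁱ(1 + t)ᵈ.
term-odd : ∀ i d j → term (suc (i * 2)) d (suc (j * 2)) ≡ 2 ^ suc (i * 2) * delay 0 i (d C_) j
term-odd i d j = cong (2 ^ suc (i * 2) *_) (lemma i j)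
  where
  lemma : ∀ i j → delay 0 (i * 2) (spread (d C_)) (j * 2) ≡ delay 0 i (d C_) j
  lemma zero    j       = spread-even (d C_) j
  lemma (suc i) zero    = refl
  lemma (suc i) (suc j) = lemma i j

-- The odd numbers 2i + 1 below n + 2 are those with i ≤ n / 2. For odd n the range on the left ends
-- with one more term, of even index, which vanishes.
sum<-half : ∀ n f → (∀ i → f (i * 2) ≡ 0) → sum< (suc (suc n)) f ≡ sum< (suc (n / 2)) (λ i → f (suc (i * 2)))
sum<-half n f even≡0 = trans (lemma (n / 2) (n % 2) (m%n<n n 2) (trans (m≡m%n+[m/n]*n n 2) (ℕ.+-comm (n % 2) _))) (sum<-odd (suc (n / 2)) f even≡0)
  where
  lemma : ∀ h r → r < 2 → n ≡ h * 2 + r → sum< (suc (suc n)) f ≡ sum< (suc h * 2) f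
  lemma h zero          _ refl = cong (λ x → sum< (suc (suc x)) f) (ℕ.+-identityʳ (h * 2))
  lemma h (suc zero)    _ refl = begin
    sum< (suc (suc (h * 2 + 1))) f          ≡⟨ cong (λ x → sum< (suc (suc x)) f) (ℕ.+-comm (h * 2) 1) ⟩
    sum< (suc (suc (suc (h * 2)))) f        ≡⟨ sum<-suc (suc h * 2) f ⟩
    sum< (suc h * 2) f + f (suc h * 2)      ≡⟨ cong (λ x → sum< (suc h * 2) f + x) (even≡0 (suc h)) ⟩
    sum< (suc h * 2) f + 0                  ≡⟨ ℕ.+-identityʳ _ ⟩
    sum< (suc h * 2) f                      ∎
  lemma h (suc (suc r)) (s≤s (s≤s ())) _

gammaCoeff : ℕ → ℕ → ℕ
gammaCoeff n i = 2 ^ suc (i * 2) * (n C suc (i * 2))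

-- Both sides are the coefficient of s²ʲ⁺¹ in (2s + (1 + s²))ⁿ⁺¹. Only odd exponents c = 2i + 1 of
-- 2s contribute, and for them `suc n ∸ c` reduces to `n ∸ i * 2`.
gamma-expansion : ∀ n j →
  sum< (suc (n / 2)) (λ i → delay 0 i (λ l → gammaCoeff (suc n) i * ((n ∸ i * 2) C l)) j) ≡ suc n * 2 C suc (j * 2)
gamma-expansion n j = begin
  sum< (suc (n / 2)) (λ i → delay 0 i (λ l → gammaCoeff (suc n) i * ((n ∸ i * 2) C l)) j)
    ≡⟨ sum<-cong (suc (n / 2)) (λ i _ → summand i) ⟨
  sum< (suc (n / 2)) (λ i → (suc n C suc (i * 2)) * term (suc (i * 2)) (n ∸ i * 2) (suc (j * 2)))
    ≡⟨ sum<-half n (λ c → (suc n C c) * term c (suc n ∸ c) (suc (j * 2)))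
         (λ i → trans (cong ((suc n C (i * 2)) *_) (term-even i _ j)) (ℕ.*-zeroʳ (suc n C (i * 2)))) ⟨
  sum< (suc (suc n)) (λ c → (suc n C c) * term c (suc n ∸ c) (suc (j * 2)))
    ≡⟨ binomialSum≡ (suc n) (λ c d → term c d (suc (j * 2))) ⟨
  binomialSum (suc n) (λ c d → term c d (suc (j * 2)))
    ≡⟨ binomialSum-term (suc n) (suc (j * 2)) ⟩
  suc n * 2 C suc (j * 2) ∎
  where
  lemma : ∀ a b c → a * (b * c) ≡ b * a * c
  lemma = solve-∀
  summand : ∀ i → (suc n C suc (i * 2)) * term (suc (i * 2)) (n ∸ i * 2) (suc (j * 2))
                ≡ delay 0 i (λ l → gammaCoeff (suc n) i * ((n ∸ i * 2) C l)) j
  summand i = begin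
    (suc n C suc (i * 2)) * term (suc (i * 2)) (n ∸ i * 2) (suc (j * 2))
      ≡⟨ cong ((suc n C suc (i * 2)) *_) (term-odd i (n ∸ i * 2) j) ⟩
    (suc n C suc (i * 2)) * (2 ^ suc (i * 2) * delay 0 i ((n ∸ i * 2) C_) j)
      ≡⟨ lemma (suc n C suc (i * 2)) (2 ^ suc (i * 2)) _ ⟩
    gammaCoeff (suc n) i * delay 0 i ((n ∸ i * 2) C_) j
      ≡⟨ delay-* (gammaCoeff (suc n) i) i ((n ∸ i * 2) C_) j ⟨
    delay 0 i (λ l → gammaCoeff (suc n) i * ((n ∸ i * 2) C l)) j ∎

-- The closed form as a gamma-polynomial

unit : ℕ → ℕ → ℕ
unit a zero    = a
unit a (suc _) = 0

sum<-zero : ∀ M → sum< M (λ _ → 0) ≡ 0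
sum<-zero zero    = refl
sum<-zero (suc M) = sum<-zero M

-- Only the summand with i = j survives. If the range stops before j, the left side is zero, and
-- `out` supplies the same for `g j`.
sum<-units : ∀ M (g : ℕ → ℕ) j → (M ≤ j → g j ≡ 0) → sum< M (λ i → delay 0 i (unit (g i)) j) ≡ g j
sum<-units zero    g j       out = sym (out z≤n)
sum<-units (suc M) g zero    out = trans (cong (λ x → g 0 + x) (sum<-zero M)) (ℕ.+-identityʳ _)
sum<-units (suc M) g (suc j) out = sum<-units M (g ∘ suc) j (out ∘ s≤s)

coeff-const-+ : ∀ a j → coeff (const (+ a)) j ≡ + unit a j
coeff-const-+ a zero    = refl
coeff-const-+ a (suc j) = refl

2*i+1≡ : ∀ i → 2 * i + 1 ≡ suc (i * 2)
2*i+1≡ = solve-∀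

closedForm : ℕ → Poly
closedForm n = ∑≤ ((n ∸ 1) / 2) (λ i → const (+ (2 ^ (2 * i + 1) * (n C (2 * i + 1)))) ⊗ X ^ₚ i)

n<2*[1+n/2] : ∀ n → n < suc (n / 2) * 2
n<2*[1+n/2] n = subst (_< suc (n / 2) * 2) (sym (m≡m%n+[m/n]*n n 2)) (ℕ.+-monoˡ-< (n / 2 * 2) (m%n<n n 2))

coeff-closedForm : ∀ m i → coeff (closedForm (suc m)) i ≡ + gammaCoeff (suc m) i
coeff-closedForm m j = begin
  coeff (closedForm (suc m)) j
    ≡⟨ coeff-∑≤ (m / 2) (λ i → const (+ (2 ^ (2 * i + 1) * (suc m C (2 * i + 1)))) ⊗ X ^ₚ i) j _ summand ⟩
  + sum< (suc (m / 2)) (λ i → delay 0 i (unit (gammaCoeff (suc m) i)) j)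
    ≡⟨ cong +_ (sum<-units (suc (m / 2)) (gammaCoeff (suc m)) j vanish) ⟩
  + gammaCoeff (suc m) j ∎
  where
  summand : ∀ i → coeff (const (+ (2 ^ (2 * i + 1) * (suc m C (2 * i + 1)))) ⊗ X ^ₚ i) j
                ≡ + delay 0 i (unit (gammaCoeff (suc m) i)) j
  summand i = begin
    coeff (const (+ (2 ^ (2 * i + 1) * (suc m C (2 * i + 1)))) ⊗ X ^ₚ i) j
      ≡⟨ cong (λ k → coeff (const (+ (2 ^ k * (suc m C k))) ⊗ X ^ₚ i) j) (2*i+1≡ i) ⟩
    coeff (const (+ gammaCoeff (suc m) i) ⊗ X ^ₚ i) j
      ≡⟨ const-⊗-X^ (+ gammaCoeff (suc m) i) i j ⟩
    coeff (monomial (+ gammaCoeff (suc m) i) i) j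
      ≡⟨ coeff-monomial (+ gammaCoeff (suc m) i) i j ⟩
    delay 0ℤ i (coeff (const (+ gammaCoeff (suc m) i))) j
      ≡⟨ delay-natural +_ 0 i _ _ (coeff-const-+ (gammaCoeff (suc m) i)) j ⟩
    + delay 0 i (unit (gammaCoeff (suc m) i)) j ∎
  vanish : suc (m / 2) ≤ j → gammaCoeff (suc m) j ≡ 0
  -- From j > m / 2 follows m < 2j, so 2j + 1 exceeds m + 1 and the binomial coefficient is zero:
  -- the truncated sum loses nothing.
  vanish m/2<j = trans (cong (2 ^ suc (j * 2) *_) (k>n⇒nCk≡0 (s≤s
      (ℕ.<-≤-trans (n<2*[1+n/2] m) (ℕ.*-monoˡ-≤ 2 m/2<j))))) (ℕ.*-zeroʳ (2 ^ suc (j * 2)))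

closedForm-vanishes : ∀ m i → m < 2 * i → coeff (closedForm (suc m)) i ≡ 0ℤ
closedForm-vanishes m i m<2i = trans (coeff-closedForm m i)
  (cong +_ (trans (cong (2 ^ suc (i * 2) *_) (k>n⇒nCk≡0 (s≤s (subst (m <_) (ℕ.*-comm 2 i) m<2i))))
                  (ℕ.*-zeroʳ (2 ^ suc (i * 2)))))

coeff-applyUpTo-< : ∀ f {M i} → i < M → coeff (applyUpTo f M) i ≡ f i
coeff-applyUpTo-< f {suc M} {zero}  i<M = refl
coeff-applyUpTo-< f {suc M} {suc i} i<M = coeff-applyUpTo-< (f ∘ suc) (s≤s⁻¹ i<M)

coeff-applyUpTo-≥ : ∀ f {M i} → M ≤ i → coeff (applyUpTo f M) i ≡ 0ℤ
coeff-applyUpTo-≥ f {zero}  {i}     M≤i = refl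
coeff-applyUpTo-≥ f {suc M} {suc i} M≤i = coeff-applyUpTo-≥ (f ∘ suc) (s≤s⁻¹ M≤i)

module _ (m : ℕ) (p : Poly) (coeff-p : ∀ j → coeff p j ≡ + (suc m * 2 C suc (j * 2))) where

  private
    -- The total 2m + 2 is even, so the reflection of binomial coefficients preserves odd lower
    -- indices: it exchanges 2i + 1 and 2(m - i) + 1. This gives the symmetry about degree m.
    reflected : ∀ i → i ≤ m → suc m * 2 C suc ((m ∸ i) * 2) ≡ suc m * 2 C suc (i * 2)
    reflected i i≤m = trans (nCk≡nC[n∸k] {suc ((m ∸ i) * 2)} {suc m * 2} (s≤s (ℕ.m≤n⇒m≤1+n (ℕ.*-monoˡ-≤ 2 (ℕ.m∸n≤m m i)))))
                            (cong (suc m * 2 C_) index)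
      where
      index : suc m * 2 ∸ suc ((m ∸ i) * 2) ≡ suc (i * 2)
      index = begin
        suc (m * 2) ∸ (m ∸ i) * 2     ≡⟨ cong (λ x → suc (m * 2) ∸ x) (ℕ.*-distribʳ-∸ 2 m i) ⟩
        suc (m * 2) ∸ (m * 2 ∸ i * 2) ≡⟨ ℕ.+-∸-assoc 1 (ℕ.m∸n≤m (m * 2) (i * 2)) ⟩
        suc (m * 2 ∸ (m * 2 ∸ i * 2)) ≡⟨ cong suc (ℕ.m∸[m∸n]≡n (ℕ.*-monoˡ-≤ 2 i≤m)) ⟩
        suc (i * 2) ∎

    vanish : ∀ i → m < i → coeff p i ≡ 0ℤ
    vanish i m<i = trans (coeff-p i) (cong +_ (k>n⇒nCk≡0 (s≤s (ℕ.*-monoˡ-≤ 2 m<i))))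

    leading : coeff p m ≢ 0ℤ
    -- Reflected at 0, the coefficient of degree m is C(2m + 2, 1) = 2m + 2, a visible successor.
    leading eq with trans (sym (trans (coeff-p m) (cong +_ (trans (reflected 0 z≤n) (nC1≡n (suc m * 2)))))) eq
    ... | ()

    reciprocal-p : p ≈ reciprocal m p
    reciprocal-p i with i ℕ.≤? m
    ... | yes i≤m = begin
      coeff p i                        ≡⟨ coeff-p i ⟩
      + (suc m * 2 C suc (i * 2))       ≡⟨ cong +_ (reflected i i≤m) ⟨
      + (suc m * 2 C suc ((m ∸ i) * 2)) ≡⟨ coeff-p (m ∸ i) ⟨
      coeff p (m ∸ i)                   ≡⟨ coeff-applyUpTo-< (λ i → coeff p (m ∸ i)) (s≤s i≤m) ⟨
      coeff (reciprocal m p) i          ∎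
    ... | no i≰m = trans (vanish i (ℕ.≰⇒> i≰m)) (sym (coeff-applyUpTo-≥ (λ i → coeff p (m ∸ i)) (ℕ.≰⇒> i≰m)))

    expansion : p ≈ ∑≤ (m / 2) (λ i → const (coeff (closedForm (suc m)) i) ⊗ X ^ₚ i ⊗ (const ℤ.1ℤ ⊕ X) ^ₚ (m ∸ 2 * i))
    expansion j = begin
      coeff p j                     ≡⟨ coeff-p j ⟩
      + (suc m * 2 C suc (j * 2))   ≡⟨ cong +_ (gamma-expansion m j) ⟨
      + sum< (suc (m / 2)) (λ i → delay 0 i (λ l → gammaCoeff (suc m) i * ((m ∸ i * 2) C l)) j)
                                    ≡⟨ coeff-∑≤ (m / 2) summandₚ j _ summand ⟨
      coeff (∑≤ (m / 2) (λ i → const (coeff (closedForm (suc m)) i) ⊗ X ^ₚ i ⊗ (const ℤ.1ℤ ⊕ X) ^ₚ (m ∸ 2 * i))) j ∎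
      where
      summandₚ : ℕ → Poly
      summandₚ i = const (coeff (closedForm (suc m)) i) ⊗ X ^ₚ i ⊗ (const ℤ.1ℤ ⊕ X) ^ₚ (m ∸ 2 * i)
      factor-coeff : ∀ i l → + gammaCoeff (suc m) i ℤ.* coeff ((const ℤ.1ℤ ⊕ X) ^ₚ (m ∸ i * 2)) l
                           ≡ + (gammaCoeff (suc m) i * ((m ∸ i * 2) C l))
      factor-coeff i l = begin
        + gammaCoeff (suc m) i ℤ.* coeff ((const ℤ.1ℤ ⊕ X) ^ₚ (m ∸ i * 2)) l
          ≡⟨ cong (+ gammaCoeff (suc m) i ℤ.*_) (coeff-binomial ℤ.1ℤ (m ∸ i * 2) l) ⟩
        + gammaCoeff (suc m) i ℤ.* (ℤ.1ℤ ℤ.^ l ℤ.* + ((m ∸ i * 2) C l))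
          ≡⟨ cong (λ x → + gammaCoeff (suc m) i ℤ.* (x ℤ.* + ((m ∸ i * 2) C l))) (ℤ.^-zeroˡ l) ⟩
        + gammaCoeff (suc m) i ℤ.* (ℤ.1ℤ ℤ.* + ((m ∸ i * 2) C l))
          ≡⟨ cong (+ gammaCoeff (suc m) i ℤ.*_) (ℤ.*-identityˡ (+ ((m ∸ i * 2) C l))) ⟩
        + gammaCoeff (suc m) i ℤ.* + ((m ∸ i * 2) C l)
          ≡⟨ ℤ.pos-* (gammaCoeff (suc m) i) ((m ∸ i * 2) C l) ⟨
        + (gammaCoeff (suc m) i * ((m ∸ i * 2) C l)) ∎
      summand : ∀ i → coeff (summandₚ i) j
                    ≡ + delay 0 i (λ l → gammaCoeff (suc m) i * ((m ∸ i * 2) C l)) j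
      summand i = begin
        coeff (const (coeff (closedForm (suc m)) i) ⊗ X ^ₚ i ⊗ (const ℤ.1ℤ ⊕ X) ^ₚ (m ∸ 2 * i)) j
          ≡⟨ cong₂ (λ c k → coeff (const c ⊗ X ^ₚ i ⊗ (const ℤ.1ℤ ⊕ X) ^ₚ (m ∸ k)) j) (coeff-closedForm m i) (ℕ.*-comm 2 i) ⟩
        coeff (const (+ gammaCoeff (suc m) i) ⊗ X ^ₚ i ⊗ (const ℤ.1ℤ ⊕ X) ^ₚ (m ∸ i * 2)) j
          ≡⟨ ⊗-congˡ (const (+ gammaCoeff (suc m) i) ⊗ X ^ₚ i) (monomial (+ gammaCoeff (suc m) i) i) (const-⊗-X^ (+ gammaCoeff (suc m) i) i) ((const ℤ.1ℤ ⊕ X) ^ₚ (m ∸ i * 2)) j ⟩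
        coeff (monomial (+ gammaCoeff (suc m) i) i ⊗ (const ℤ.1ℤ ⊕ X) ^ₚ (m ∸ i * 2)) j
          ≡⟨ coeff-monomial-⊗ (+ gammaCoeff (suc m) i) i _ j ⟩
        delay 0ℤ i (λ l → + gammaCoeff (suc m) i ℤ.* coeff ((const ℤ.1ℤ ⊕ X) ^ₚ (m ∸ i * 2)) l) j
          ≡⟨ delay-natural +_ 0 i _ _ (factor-coeff i) j ⟩
        + delay 0 i (λ l → gammaCoeff (suc m) i * ((m ∸ i * 2) C l)) j ∎

  closedForm-isGamma : IsGammaPolynomial p (closedForm (suc m))
  closedForm-isGamma = m , ((leading , vanish) , reciprocal-p) , closedForm-vanishes m , expansion

-- The closed form in the variable √t

parity : ∀ j → ∃[ i ] (j ≡ i * 2 ⊎ j ≡ suc (i * 2))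
parity zero          = 0 , inj₁ refl
parity (suc zero)    = 0 , inj₂ refl
parity (suc (suc j)) with parity j
... | i , inj₁ eq = suc i , inj₁ (cong (λ (l : ℕ) → suc (suc l)) eq)
... | i , inj₂ eq = suc i , inj₂ (cong (λ (l : ℕ) → suc (suc l)) eq)

pos-^ : ∀ a j → (+ a) ℤ.^ j ≡ + (a ^ j)
pos-^ a zero    = refl
pos-^ a (suc j) = trans (cong (+ a ℤ.*_) (pos-^ a j)) (sym (ℤ.pos-* a (a ^ j)))

-2^even : ∀ i → -[1+ 1 ] ℤ.^ (i * 2) ≡ + (2 ^ (i * 2))
-2^even zero    = refl
-2^even (suc i) = begin
  -[1+ 1 ] ℤ.* (-[1+ 1 ] ℤ.* -[1+ 1 ] ℤ.^ (i * 2)) ≡⟨ ℤ.*-assoc -[1+ 1 ] -[1+ 1 ] _ ⟨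
  + 4 ℤ.* -[1+ 1 ] ℤ.^ (i * 2)                     ≡⟨ cong (+ 4 ℤ.*_) (-2^even i) ⟩
  + 4 ℤ.* + (2 ^ (i * 2))                           ≡⟨ ℤ.pos-* 4 (2 ^ (i * 2)) ⟨
  + (4 * 2 ^ (i * 2))                               ≡⟨ cong +_ (ℕ.*-assoc 2 2 (2 ^ (i * 2))) ⟩
  + (2 * (2 * 2 ^ (i * 2)))                         ∎

-2^odd : ∀ i → -[1+ 1 ] ℤ.^ suc (i * 2) ≡ ℤ.- + (2 ^ suc (i * 2))
-2^odd i = begin
  -[1+ 1 ] ℤ.* -[1+ 1 ] ℤ.^ (i * 2)   ≡⟨ cong (-[1+ 1 ] ℤ.*_) (-2^even i) ⟩
  -[1+ 1 ] ℤ.* + (2 ^ (i * 2))        ≡⟨ ℤ.neg-distribˡ-* (+ 2) (+ (2 ^ (i * 2))) ⟨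
  ℤ.- (+ 2 ℤ.* + (2 ^ (i * 2)))       ≡⟨ cong ℤ.-_ (ℤ.pos-* 2 (2 ^ (i * 2))) ⟨
  ℤ.- + (2 ^ suc (i * 2))             ∎

-- The variable is s = √t, and the denominator 2s is cleared. In the difference of the two powers
-- the even coefficients cancel and the odd ones double; that factor 2 is the one in 2s, and the
-- factor s shifts the even polynomial γ(s²) to odd degrees.
closedForm-√ : ∀ m → (const (+ 2) ⊗ X) ⊗ (closedForm (suc m) ∘ₚ (X ^ₚ 2))
  ≈ (const (+ 1) ⊕ const (+ 2) ⊗ X) ^ₚ suc m ⊖ (const (+ 1) ⊖ const (+ 2) ⊗ X) ^ₚ suc m
closedForm-√ m j = trans (left j) (sym (right j))
  where
  γ = closedForm (suc m)
  n = suc m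
  value : ℕ → ℤ
  value j = (+ 2) ℤ.^ j ℤ.* + (n C j) ℤ.+ (ℤ.- (-[1+ 1 ] ℤ.^ j ℤ.* + (n C j)))
  right : ∀ j → coeff ((const (+ 1) ⊕ const (+ 2) ⊗ X) ^ₚ n ⊖ (const (+ 1) ⊖ const (+ 2) ⊗ X) ^ₚ n) j ≡ value j
  right j = begin
    coeff ((const (+ 1) ⊕ const (+ 2) ⊗ X) ^ₚ n ⊖ (const (+ 1) ⊖ const (+ 2) ⊗ X) ^ₚ n) j
      ≡⟨ coeff-⊕ ((+ 1 ∷ + 2 ∷ []) ^ₚ n) (map ℤ.-_ ((+ 1 ∷ -[1+ 1 ] ∷ []) ^ₚ n)) j ⟩
    coeff ((+ 1 ∷ + 2 ∷ []) ^ₚ n) j ℤ.+ coeff (map ℤ.-_ ((+ 1 ∷ -[1+ 1 ] ∷ []) ^ₚ n)) j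
      ≡⟨ cong₂ ℤ._+_ (coeff-binomial (+ 2) n j)
           (trans (coeff-map ℤ.-_ refl ((+ 1 ∷ -[1+ 1 ] ∷ []) ^ₚ n) j) (cong ℤ.-_ (coeff-binomial -[1+ 1 ] n j))) ⟩
    value j ∎
  value-even : ∀ i → value (i * 2) ≡ 0ℤ
  value-even i = begin
    value (i * 2)
      ≡⟨ cong₂ (λ a b → a ℤ.* + (n C (i * 2)) ℤ.+ (ℤ.- (b ℤ.* + (n C (i * 2))))) (pos-^ 2 (i * 2)) (-2^even i) ⟩
    + (2 ^ (i * 2)) ℤ.* + (n C (i * 2)) ℤ.+ (ℤ.- (+ (2 ^ (i * 2)) ℤ.* + (n C (i * 2))))
      ≡⟨ ℤ.+-inverseʳ (+ (2 ^ (i * 2)) ℤ.* + (n C (i * 2))) ⟩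
    0ℤ ∎
  value-odd : ∀ i → value (suc (i * 2)) ≡ + 2 ℤ.* + gammaCoeff n i
  value-odd i = begin
    value (suc (i * 2))
      ≡⟨ cong₂ (λ a b → a ℤ.* c ℤ.+ (ℤ.- (b ℤ.* c))) (pos-^ 2 (suc (i * 2))) (-2^odd i) ⟩
    a ℤ.* c ℤ.+ (ℤ.- ((ℤ.- a) ℤ.* c))
      ≡⟨ cong (λ x → a ℤ.* c ℤ.+ ℤ.- x) (ℤ.neg-distribˡ-* a c) ⟨
    a ℤ.* c ℤ.+ (ℤ.- (ℤ.- (a ℤ.* c)))
      ≡⟨ cong (λ x → a ℤ.* c ℤ.+ x) (ℤ.neg-involutive (a ℤ.* c)) ⟩
    a ℤ.* c ℤ.+ a ℤ.* c
      ≡⟨ cong₂ ℤ._+_ (ℤ.pos-* (2 ^ suc (i * 2)) (n C suc (i * 2))) (ℤ.pos-* (2 ^ suc (i * 2)) (n C suc (i * 2))) ⟨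
    + (gammaCoeff n i + gammaCoeff n i)
      ≡⟨ cong (λ x → + (gammaCoeff n i + x)) (ℕ.+-identityʳ _) ⟨
    + (2 * gammaCoeff n i)
      ≡⟨ ℤ.pos-* 2 (gammaCoeff n i) ⟩
    + 2 ℤ.* + gammaCoeff n i ∎
    where
    a = + (2 ^ suc (i * 2))
    c = + (n C suc (i * 2))
  q = γ ∘ₚ (X ^ₚ 2)
  left-suc : ∀ j → coeff ((const (+ 2) ⊗ X) ⊗ q) (suc j) ≡ + 2 ℤ.* coeff q j
  left-suc j = trans (coeff-linear-⊗ 0ℤ (+ 2) q j) (ℤ.+-identityˡ _)
  left : ∀ j → coeff ((const (+ 2) ⊗ X) ⊗ q) j ≡ value j
  left zero    = coeff-⊗-zero 0ℤ (+ 2 ∷ []) q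
  left (suc j) with parity j
  ... | i , inj₁ refl = let (even , _) = coeff-∘X² γ i in begin
    coeff ((const (+ 2) ⊗ X) ⊗ q) (suc (i * 2)) ≡⟨ left-suc (i * 2) ⟩
    + 2 ℤ.* coeff q (i * 2)                     ≡⟨ cong (+ 2 ℤ.*_) (trans even (coeff-closedForm m i)) ⟩
    + 2 ℤ.* + gammaCoeff n i                    ≡⟨ value-odd i ⟨
    value (suc (i * 2))                         ∎
  ... | i , inj₂ refl = let (_ , odd) = coeff-∘X² γ i in begin
    coeff ((const (+ 2) ⊗ X) ⊗ q) (suc (suc (i * 2))) ≡⟨ left-suc (suc (i * 2)) ⟩
    + 2 ℤ.* coeff q (suc (i * 2))               ≡⟨ cong (+ 2 ℤ.*_) odd ⟩
    0ℤ                                          ≡⟨ value-even (suc i) ⟨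
    value (suc i * 2)                           ∎

-- Counting words

length-filter-map : {A B : Set} {P : B → Set} (P? : Decidable P) (f : A → B) (xs : List A) →
  length (filter P? (map f xs)) ≡ length (filter (P? ∘ f) xs)
length-filter-map P? f []       = refl
length-filter-map P? f (x ∷ xs) with P? (f x)
... | yes _ = cong suc (length-filter-map P? f xs)
... | no  _ = length-filter-map P? f xs

letters : List Step
letters = N ∷ E ∷ []

-- The predicate is on lists, not on vectors of a fixed length, so that fixing the first letter of a
-- word only composes the predicate with a cons.
wordCount : {P : Path → Set} → Decidable P → ℕ → ℕ
wordCount P? n = length (filter (P? ∘ toList) (words letters n))

wordCount-suc : {P : Path → Set} (P? : Decidable P) → ∀ n →
  wordCount P? (suc n) ≡ wordCount (λ w → P? (N ∷ w)) n + wordCount (λ w → P? (E ∷ w)) n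
wordCount-suc P? n = begin
  length (filter Q? (map (N Vec.∷_) ws ++ (map (E Vec.∷_) ws ++ [])))
    ≡⟨ cong (λ l → length (filter Q? (map (N Vec.∷_) ws ++ l))) (List.++-identityʳ _) ⟩
  length (filter Q? (map (N Vec.∷_) ws ++ map (E Vec.∷_) ws))
    ≡⟨ cong length (List.filter-++ Q? (map (N Vec.∷_) ws) _) ⟩
  length (filter Q? (map (N Vec.∷_) ws) ++ filter Q? (map (E Vec.∷_) ws))
    ≡⟨ List.length-++ (filter Q? (map (N Vec.∷_) ws)) ⟩
  length (filter Q? (map (N Vec.∷_) ws)) + length (filter Q? (map (E Vec.∷_) ws))
    ≡⟨ cong₂ _+_ (length-filter-map Q? (N Vec.∷_) ws) (length-filter-map Q? (E Vec.∷_) ws) ⟩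
  wordCount (λ w → P? (N ∷ w)) n + wordCount (λ w → P? (E ∷ w)) n ∎
  where
  ws = words letters n
  Q? = λ {m} (v : Vec Step m) → P? (toList v)

wordCount-cong : {P Q : Path → Set} (P? : Decidable P) (Q? : Decidable Q) → P ≐ Q →
  ∀ n → wordCount P? n ≡ wordCount Q? n
wordCount-cong P? Q? (P⇒Q , Q⇒P) n =
  cong length (List.filter-≐ (P? ∘ toList) (Q? ∘ toList) (P⇒Q , Q⇒P) (words letters n))

wordCount-none : {P : Path → Set} (P? : Decidable P) → (∀ w → ¬ P w) → ∀ n → wordCount P? n ≡ 0
wordCount-none P? none n =
  cong length (List.filter-none (P? ∘ toList) {words letters n} (All.universal (λ v → none (toList v)) (words letters n)))

-- The number of factors NE in `c ∷ w`: the argument `c` is the letter to the left of `w`.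
peaks : Step → Path → ℕ
peaks c []      = 0
peaks c (N ∷ w) = peaks N w
peaks N (E ∷ w) = suc (peaks E w)
peaks E (E ∷ w) = peaks E w

peaks? : ∀ c j → Decidable (λ w → peaks c w ≡ j)
peaks? c j w = peaks c w ℕ.≟ j

-- Put the word between E and a final N: it corresponds to a choice of 2j + 1 changes among l + 1
-- places. With N on the left the ends agree and the number of changes is even, as in the companion
-- count. The two inductions depend on each other because the first letter becomes the left
-- neighbour of the rest.
wordCount-peaks-E : ∀ l j → wordCount (peaks? E j) l ≡ suc l C suc (j * 2)
wordCount-peaks-N : ∀ l j → wordCount (peaks? N j) l ≡ suc l C (j * 2)

wordCount-peaks-E zero    zero    = refl
wordCount-peaks-E zero    (suc j) = sym (k>n⇒nCk≡0 {1} {suc (suc j * 2)} (s≤s z<s))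
wordCount-peaks-E (suc l) j       = begin
  wordCount (peaks? E j) (suc l)                          ≡⟨ wordCount-suc (peaks? E j) l ⟩
  wordCount (peaks? N j) l + wordCount (peaks? E j) l   ≡⟨ cong₂ _+_ (wordCount-peaks-N l j) (wordCount-peaks-E l j) ⟩
  suc l C (j * 2) + suc l C suc (j * 2)                     ≡⟨ nCk+nC[k+1]≡[n+1]C[k+1] (suc l) (j * 2) ⟩
  suc (suc l) C suc (j * 2)                                 ∎
wordCount-peaks-N zero    zero    = refl
wordCount-peaks-N zero    (suc j) = sym (k>n⇒nCk≡0 {1} {suc j * 2} (s≤s z<s))
wordCount-peaks-N (suc l) zero    = begin
  wordCount (peaks? N 0) (suc l)                          ≡⟨ wordCount-suc (peaks? N 0) l ⟩
  wordCount (peaks? N 0) l + wordCount (λ w → peaks? N 0 (E ∷ w)) l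
    ≡⟨ cong₂ _+_ (wordCount-peaks-N l 0) (wordCount-none (λ w → peaks? N 0 (E ∷ w)) (λ w ()) l) ⟩
  1                                                         ∎
wordCount-peaks-N (suc l) (suc j) = begin
  wordCount (peaks? N (suc j)) (suc l)                    ≡⟨ wordCount-suc (peaks? N (suc j)) l ⟩
  wordCount (peaks? N (suc j)) l + wordCount (λ w → peaks? N (suc j) (E ∷ w)) l
    ≡⟨ cong (λ x → wordCount (peaks? N (suc j)) l + x) (wordCount-cong (λ w → peaks? N (suc j) (E ∷ w)) (peaks? E j) (ℕ.suc-injective , cong suc) l) ⟩
  wordCount (peaks? N (suc j)) l + wordCount (peaks? E j) l
    ≡⟨ cong₂ _+_ (wordCount-peaks-N l (suc j)) (wordCount-peaks-E l j) ⟩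
  suc l C (suc j * 2) + suc l C suc (j * 2)                 ≡⟨ pascal (suc l) (suc (j * 2)) ⟨
  suc (suc l) C (suc j * 2)                                 ∎

Allowed : Step → Step → Step → Set
Allowed E N E = ⊥
Allowed N E N = ⊥
Allowed _ _ _ = ⊤

allowed? : ∀ a b c → Dec (Allowed a b c)
allowed? E N E = no λ ()
allowed? N E N = no λ ()
allowed? N N N = yes tt
allowed? N N E = yes tt
allowed? N E E = yes tt
allowed? E N N = yes tt
allowed? E E N = yes tt
allowed? E E E = yes tt

-- Here `c` stands in an odd position. Each step consumes the even letter `s` and the next odd
-- letter `c′`, which is shared with the following triple.
Avoids : Step → Path → Set
Avoids c (s ∷ c′ ∷ w) = Allowed c s c′ × Avoids c′ w
Avoids c _            = ⊤

avoids? : ∀ c → Decidable (Avoids c)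
avoids? c (s ∷ c′ ∷ w) = allowed? c s c′ ×-dec avoids? c′ w
avoids? c []           = yes tt
avoids? c (s ∷ [])     = yes tt

-- For c = E the word `c ∷ w ++ N ∷ []` is the augmented word LN. A general `c` is needed for the
-- recursion from one odd position to the next.
Avoiding : Step → ℕ → Path → Set
Avoiding c i w = peaks c w ≡ i × Avoids c (w ++ N ∷ [])

avoiding? : ∀ c i → Decidable (Avoiding c i)
avoiding? c i w = (peaks c w ℕ.≟ i) ×-dec avoids? c (w ++ N ∷ [])

wordCount-suc² : {P : Path → Set} (P? : Decidable P) → ∀ n → wordCount P? (suc (suc n)) ≡
    (wordCount (λ w → P? (N ∷ N ∷ w)) n + wordCount (λ w → P? (N ∷ E ∷ w)) n)
  + (wordCount (λ w → P? (E ∷ N ∷ w)) n + wordCount (λ w → P? (E ∷ E ∷ w)) n)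
wordCount-suc² P? n = trans (wordCount-suc P? (suc n))
  (cong₂ _+_ (wordCount-suc (λ w → P? (N ∷ w)) n) (wordCount-suc (λ w → P? (E ∷ w)) n))

-- The letters of cwN in odd positions determine those in even positions,
-- except that both letters are possible between two different ones.
wordCount-avoiding-E : ∀ m i → wordCount (avoiding? E i) (suc (m * 2)) ≡ 2 ^ suc (i * 2) * (suc m C suc (i * 2))
wordCount-avoiding-N : ∀ m i → wordCount (avoiding? N i) (suc (m * 2)) ≡ 2 ^ (i * 2) * (suc m C (i * 2))

wordCount-avoiding-E zero zero    = refl
wordCount-avoiding-E zero (suc i) =
  sym (trans (cong (2 ^ suc (suc i * 2) *_) (k>n⇒nCk≡0 {1} {suc (suc i * 2)} (s≤s z<s))) (ℕ.*-zeroʳ (2 ^ suc (suc i * 2))))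
wordCount-avoiding-E (suc m) i    = begin
  wordCount (avoiding? E i) (suc (suc m * 2))
    ≡⟨ wordCount-suc² (avoiding? E i) l ⟩
  (wordCount (λ w → avoiding? E i (N ∷ N ∷ w)) l + wordCount (λ w → avoiding? E i (N ∷ E ∷ w)) l)
    + (wordCount (λ w → avoiding? E i (E ∷ N ∷ w)) l + wordCount (λ w → avoiding? E i (E ∷ E ∷ w)) l)
    ≡⟨ cong₂ _+_
        (cong₂ _+_ (wordCount-cong (λ w → avoiding? E i (N ∷ N ∷ w)) (avoiding? N i) ((λ (v , _ , a) → v , a) , (λ (v , a) → v , tt , a)) l)
                   (wordCount-none (λ w → avoiding? E i (N ∷ E ∷ w)) (λ { w (_ , () , _) }) l))
        (cong₂ _+_ (wordCount-cong (λ w → avoiding? E i (E ∷ N ∷ w)) (avoiding? N i) ((λ (v , _ , a) → v , a) , (λ (v , a) → v , tt , a)) l)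
                   (wordCount-cong (λ w → avoiding? E i (E ∷ E ∷ w)) (avoiding? E i) ((λ (v , _ , a) → v , a) , (λ (v , a) → v , tt , a)) l)) ⟩
  (wordCount (avoiding? N i) l + 0) + (wordCount (avoiding? N i) l + wordCount (avoiding? E i) l)
    ≡⟨ cong₂ (λ a b → (a + 0) + (a + b)) (wordCount-avoiding-N m i) (wordCount-avoiding-E m i) ⟩
  (2 ^ (i * 2) * (suc m C (i * 2)) + 0) + (2 ^ (i * 2) * (suc m C (i * 2)) + 2 ^ suc (i * 2) * (suc m C suc (i * 2)))
    ≡⟨ lemma (2 ^ (i * 2)) (suc m C (i * 2)) (suc m C suc (i * 2)) ⟩
  2 ^ suc (i * 2) * (suc m C suc (i * 2) + suc m C (i * 2))
    ≡⟨ cong (2 ^ suc (i * 2) *_) (pascal (suc m) (i * 2)) ⟨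
  2 ^ suc (i * 2) * (suc (suc m) C suc (i * 2)) ∎
  where
  l = suc (m * 2)
  lemma : ∀ p a b → (p * a + 0) + (p * a + 2 * p * b) ≡ 2 * p * (b + a)
  lemma = solve-∀
wordCount-avoiding-N zero zero    = refl
wordCount-avoiding-N zero (suc i) =
  trans (lemma i) (sym (trans (cong (2 ^ (suc i * 2) *_) (k>n⇒nCk≡0 {1} {suc i * 2} (s≤s z<s))) (ℕ.*-zeroʳ (2 ^ (suc i * 2)))))
  where
  lemma : ∀ i → wordCount (avoiding? N (suc i)) 1 ≡ 0
  lemma zero    = refl
  lemma (suc i) = refl
wordCount-avoiding-N (suc m) zero = begin
  wordCount (avoiding? N 0) (suc (suc m * 2))
    ≡⟨ wordCount-suc² (avoiding? N 0) l ⟩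
  (wordCount (λ w → avoiding? N 0 (N ∷ N ∷ w)) l + wordCount (λ w → avoiding? N 0 (N ∷ E ∷ w)) l)
    + (wordCount (λ w → avoiding? N 0 (E ∷ N ∷ w)) l + wordCount (λ w → avoiding? N 0 (E ∷ E ∷ w)) l)
    ≡⟨ cong₂ _+_
        (cong₂ _+_ (wordCount-cong (λ w → avoiding? N 0 (N ∷ N ∷ w)) (avoiding? N 0) ((λ (v , _ , a) → v , a) , (λ (v , a) → v , tt , a)) l)
                   (wordCount-none (λ w → avoiding? N 0 (N ∷ E ∷ w)) (λ { w (() , _) }) l))
        (cong₂ _+_ (wordCount-none (λ w → avoiding? N 0 (E ∷ N ∷ w)) (λ { w (() , _) }) l)
                   (wordCount-none (λ w → avoiding? N 0 (E ∷ E ∷ w)) (λ { w (() , _) }) l)) ⟩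
  (wordCount (avoiding? N 0) l + 0) + 0
    ≡⟨ cong (λ a → (a + 0) + 0) (wordCount-avoiding-N m 0) ⟩
  1 ∎
  where
  l = suc (m * 2)
wordCount-avoiding-N (suc m) (suc i) = begin
  wordCount (avoiding? N (suc i)) (suc (suc m * 2))
    ≡⟨ wordCount-suc² (avoiding? N (suc i)) l ⟩
  (wordCount (λ w → avoiding? N (suc i) (N ∷ N ∷ w)) l + wordCount (λ w → avoiding? N (suc i) (N ∷ E ∷ w)) l)
    + (wordCount (λ w → avoiding? N (suc i) (E ∷ N ∷ w)) l + wordCount (λ w → avoiding? N (suc i) (E ∷ E ∷ w)) l)
    ≡⟨ cong₂ _+_
        (cong₂ _+_ (wordCount-cong (λ w → avoiding? N (suc i) (N ∷ N ∷ w)) (avoiding? N (suc i)) ((λ (v , _ , a) → v , a) , (λ (v , a) → v , tt , a)) l)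
                   (wordCount-cong (λ w → avoiding? N (suc i) (N ∷ E ∷ w)) (avoiding? E i) ((λ (v , _ , a) → ℕ.suc-injective v , a) , (λ (v , a) → cong suc v , tt , a)) l))
        (cong₂ _+_ (wordCount-none (λ w → avoiding? N (suc i) (E ∷ N ∷ w)) (λ { w (_ , () , _) }) l)
                   (wordCount-cong (λ w → avoiding? N (suc i) (E ∷ E ∷ w)) (avoiding? E i) ((λ (v , _ , a) → ℕ.suc-injective v , a) , (λ (v , a) → cong suc v , tt , a)) l)) ⟩
  (wordCount (avoiding? N (suc i)) l + wordCount (avoiding? E i) l) + (0 + wordCount (avoiding? E i) l)
    ≡⟨ cong₂ (λ a b → (a + b) + (0 + b)) (wordCount-avoiding-N m (suc i)) (wordCount-avoiding-E m i) ⟩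
  (2 * (2 * p) * (suc m C (suc i * 2)) + 2 * p * (suc m C suc (i * 2))) + (0 + 2 * p * (suc m C suc (i * 2)))
    ≡⟨ lemma p (suc m C (suc i * 2)) (suc m C suc (i * 2)) ⟩
  2 ^ (suc i * 2) * (suc m C (suc i * 2) + suc m C suc (i * 2))
    ≡⟨ cong (2 ^ (suc i * 2) *_) (pascal (suc m) (suc (i * 2))) ⟨
  2 ^ (suc i * 2) * (suc (suc m) C (suc i * 2)) ∎
  where
  l = suc (m * 2)
  p = 2 ^ (i * 2)
  lemma : ∀ p a b → (2 * (2 * p) * a + 2 * p * b) + (0 + 2 * p * b) ≡ 2 * (2 * p) * (a + b)
  lemma = solve-∀

-- Cardinalities of filtered lists

unique⇒↭ : {A : Set} {xs ys : List A} → Unique xs → Unique ys →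
  (∀ {z} → z ∈ xs → z ∈ ys) → (∀ {z} → z ∈ ys → z ∈ xs) → xs ↭ ys
unique⇒↭ xs! ys! xs⊆ys ys⊆xs = ∼bag⇒↭ (unique∧set⇒bag xs! ys! (mk⇔ xs⊆ys ys⊆xs))

length-filter-⊆∪ : {A : Set} {P Q R : A → Set} (P? : Decidable P) (Q? : Decidable Q) (R? : Decidable R) →
  (∀ {x} → P x → Q x ⊎ R x) → ∀ xs → length (filter P? xs) ≤ length (filter Q? xs) + length (filter R? xs)
length-filter-⊆∪ P? Q? R? P⊆Q∪R []       = z≤n
length-filter-⊆∪ P? Q? R? P⊆Q∪R (x ∷ xs) with ih ← length-filter-⊆∪ P? Q? R? P⊆Q∪R xs | P? x | Q? x | R? x
... | no _  | no _  | no _  = ih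
... | no _  | no _  | yes _ = ℕ.≤-trans ih (ℕ.+-monoʳ-≤ (length (filter Q? xs)) (ℕ.n≤1+n _))
... | no _  | yes _ | no _  = ℕ.m≤n⇒m≤1+n ih
... | no _  | yes _ | yes _ = ℕ.m≤n⇒m≤1+n (ℕ.≤-trans ih (ℕ.+-monoʳ-≤ (length (filter Q? xs)) (ℕ.n≤1+n _)))
... | yes _ | yes _ | no _  = s≤s ih
... | yes _ | yes _ | yes _ = s≤s (ℕ.≤-trans ih (ℕ.+-monoʳ-≤ (length (filter Q? xs)) (ℕ.n≤1+n _)))
... | yes _ | no _  | yes _ = subst (suc (length (filter P? xs)) ≤_) (sym (ℕ.+-suc (length (filter Q? xs)) _)) (s≤s ih)
... | yes p | no ¬q | no ¬r with P⊆Q∪R p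
...   | inj₁ q = contradiction q ¬q
...   | inj₂ r = contradiction r ¬r

length-filter-⊆ : {A : Set} {P Q : A → Set} (P? : Decidable P) (Q? : Decidable Q) →
  (∀ {x} → P x → Q x) → ∀ xs → length (filter P? xs) ≤ length (filter Q? xs)
length-filter-⊆ P? Q? P⊆Q []       = z≤n
length-filter-⊆ P? Q? P⊆Q (x ∷ xs) with ih ← length-filter-⊆ P? Q? P⊆Q xs | P? x | Q? x
... | no _  | no _  = ih
... | no _  | yes _ = ℕ.m≤n⇒m≤1+n ih
... | yes _ | yes _ = s≤s ih
... | yes p | no ¬q = contradiction (P⊆Q p) ¬q

length-filter-disjoint : {A : Set} {P Q R : A → Set} (P? : Decidable P) (Q? : Decidable Q) (R? : Decidable R) →
  (∀ {x} → Q x → P x) → (∀ {x} → R x → P x) → (∀ {x} → Q x → ¬ R x) →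
  ∀ xs → length (filter Q? xs) + length (filter R? xs) ≤ length (filter P? xs)
length-filter-disjoint P? Q? R? Q⊆P R⊆P Q∩R≡∅ []       = z≤n
length-filter-disjoint P? Q? R? Q⊆P R⊆P Q∩R≡∅ (x ∷ xs)
  with ih ← length-filter-disjoint P? Q? R? Q⊆P R⊆P Q∩R≡∅ xs | P? x | Q? x | R? x
... | no _  | no _  | no _  = ih
... | yes _ | no _  | no _  = ℕ.m≤n⇒m≤1+n ih
... | yes _ | yes _ | no _  = s≤s ih
... | yes _ | no _  | yes _ = subst (_≤ suc (length (filter P? xs))) (sym (ℕ.+-suc (length (filter Q? xs)) _)) (s≤s ih)
... | _     | yes q | yes r = contradiction r (Q∩R≡∅ q)
... | no ¬p | yes q | no _  = contradiction (Q⊆P q) ¬p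
... | no ¬p | no _  | yes r = contradiction (R⊆P r) ¬p

length-filter≤1 : {A : Set} {P : A → Set} (P? : Decidable P) → (∀ {x y} → P x → P y → x ≡ y) →
  ∀ {xs} → Unique xs → length (filter P? xs) ≤ 1
length-filter≤1 P? P-prop {xs} xs! = go (All.all-filter P? xs) (Unique.filter⁺ P? xs!)
  where
  go : ∀ {ys} → All _ ys → Unique ys → length ys ≤ 1
  go []            _                  = z≤n
  go (_ ∷ [])      _                  = s≤s z≤n
  go (p ∷ p′ ∷ _) ((x≢y ∷ _) ∷ _)    = contradiction (P-prop p p′) x≢y

length-filter≥1 : {A : Set} {P : A → Set} (P? : Decidable P) → ∀ {x xs} → x ∈ xs → P x → 1 ≤ length (filter P? xs)
length-filter≥1 {P = P} P? x∈xs px = List.filter-some P? (lose x∈xs px)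

-- Peak-cliques

module Columns {m : ℕ} (a : Vec ℕ m) where

  -- The abscissa of the N step with index i.
  column : Fin m → ℕ
  column i = toℕ i ∸ lookup a i

  -- Vacuous at the last index, as it should be: the final N step of a path is the last one of its
  -- column.
  LastInColumn : Fin m → Set
  LastInColumn j = ∀ j⁺ → toℕ j⁺ ≡ suc (toℕ j) → column j < column j⁺

  lastInColumn? : Decidable LastInColumn
  lastInColumn? j = Fin.all? λ j⁺ → (toℕ j⁺ ℕ.≟ suc (toℕ j)) →-dec (column j ℕ.<? column j⁺)

  column≤toℕ : ∀ i → column i ≤ toℕ i
  column≤toℕ i = ℕ.m∸n≤m (toℕ i) (lookup a i)

  edge⇒column : ∀ {j i} → Edge a j i → column i ≤ toℕ j
  edge⇒column {j} {i} (_ , i≤j+a) = ℕ.m≤n+o⇒m∸n≤o (toℕ i) (lookup a i) (subst (toℕ i ≤_) (ℕ.+-comm (toℕ j) _) i≤j+a)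

  column⇒edge : ∀ {j i} → toℕ j < toℕ i → column i ≤ toℕ j → Edge a j i
  column⇒edge {j} {i} j<i c≤j = j<i ,
    ℕ.≤-trans (ℕ.m≤n+m∸n (toℕ i) (lookup a i)) (subst (lookup a i + column i ≤_) (ℕ.+-comm (lookup a i) _) (ℕ.+-monoʳ-≤ (lookup a i) c≤j))

  predecessor : ∀ (i : Fin m) {h} → toℕ i ≡ suc h → ∃[ i⁻ ] toℕ {m} i⁻ ≡ h
  predecessor i {h} eq = fromℕ< h<m , Fin.toℕ-fromℕ< h<m
    where
    h<m : h < m
    h<m = ℕ.<-trans (subst (h <_) (sym eq) (ℕ.n<1+n h)) (Fin.toℕ<n i)

  module Monotone (area : IsAreaSequence a) where

    -- Since `suc (toℕ h) ∸ suc (lookup a h)` reduces to `column h`, the growth condition on area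
    -- sequences is monotonicity of the columns.
    column-step : ∀ h i → toℕ i ≡ suc (toℕ h) → column h ≤ column i
    column-step h i eq = begin′
      toℕ h ∸ lookup a h               ≤⟨ ℕ.∸-monoʳ-≤ (suc (toℕ h)) (proj₂ area h i eq) ⟩
      suc (toℕ h) ∸ lookup a i         ≤⟨ ℕ.≤-reflexive (cong (_∸ lookup a i) (sym eq)) ⟩
      toℕ i ∸ lookup a i               ∎′
      where open ℕ.≤-Reasoning using (step-≤) renaming (begin_ to begin′_; _∎ to _∎′)

    column-mono : ∀ h i → toℕ h ≤ toℕ i → column h ≤ column i
    column-mono h i h≤i = go (toℕ i) i refl h≤i
      where
      go : ∀ t i → toℕ i ≡ t → toℕ h ≤ t → column h ≤ column i
      go t i eq h≤t with ℕ.m≤n⇒m<n∨m≡n h≤t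
      go t i eq h≤t | inj₂ h≡t with refl ← Fin.toℕ-injective (trans h≡t (sym eq)) = ℕ.≤-refl
      go (suc t) i eq h≤t | inj₁ h<t with predecessor i eq
      ... | i⁻ , eq⁻ = ℕ.≤-trans (go t i⁻ eq⁻ (s≤s⁻¹ h<t)) (column-step i⁻ i (trans eq (cong suc (sym eq⁻))))

    -- The smaller neighbours of j are the vertices from `column j` up to j - 1. If the edge cannot
    -- be extended to the left, then i equals `column j`; if it cannot be extended to the right, the
    -- next column exceeds i. An isolated vertex is the case i = j of the same description.
    peakEdge⇒ : ∀ {i j} → PeakEdge a i j → toℕ i ≡ column j × LastInColumn j
    peakEdge⇒ {i} (inj₁ (refl , isolated)) = sym column≡ , last
      where
      column≡ : column i ≡ toℕ i
      column≡ = ℕ.≤-antisym (column≤toℕ i) (ℕ.≮⇒≥ not<)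
        where
        not< : ¬ column i < toℕ i
        not< c<i = go (toℕ i) refl c<i
          where
          go : ∀ t → toℕ i ≡ t → column i < t → ⊥
          go (suc t) eq c<t with predecessor i eq
          ... | i⁻ , refl = isolated i⁻ (inj₂ (column⇒edge (subst (toℕ i⁻ <_) (sym eq) (ℕ.n<1+n _)) (s≤s⁻¹ c<t)))
      last : LastInColumn i
      last j⁺ eq = ℕ.≰⇒> λ c≤ → isolated j⁺ (inj₁ (column⇒edge (subst (toℕ i <_) (sym eq) (ℕ.n<1+n _)) (ℕ.≤-trans c≤ (column≤toℕ i))))
    peakEdge⇒ {i} {j} (inj₂ (edge , right , left)) = sym column≡ , last
      where
      c≤i = edge⇒column edge
      column≡ : column j ≡ toℕ i
      column≡ = ℕ.≤-antisym c≤i (ℕ.≮⇒≥ not<)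
        where
        not< : ¬ column j < toℕ i
        not< c<i = go (toℕ i) refl c<i
          where
          go : ∀ t → toℕ i ≡ t → column j < t → ⊥
          go (suc t) eq c<t with predecessor i eq
          ... | i⁻ , refl = left i⁻ eq (inj₁ (column⇒edge (ℕ.<-trans (subst (toℕ i⁻ <_) (sym eq) (ℕ.n<1+n _)) (proj₁ edge)) (s≤s⁻¹ c<t)))
      last : LastInColumn j
      last j⁺ eq = ℕ.≰⇒> λ c≤ → right j⁺ eq
        (inj₁ (column⇒edge (ℕ.<-trans (proj₁ edge) (subst (toℕ j <_) (sym eq) (ℕ.n<1+n _))) (ℕ.≤-trans c≤ c≤i)))

    peakEdge⇐ : ∀ {i j} → toℕ i ≡ column j → LastInColumn j → PeakEdge a i j
    peakEdge⇐ {i} {j} i≡c last with ℕ.m≤n⇒m<n∨m≡n (subst (_≤ toℕ j) (sym i≡c) (column≤toℕ j))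
    ... | inj₂ i≡j with refl ← Fin.toℕ-injective i≡j = inj₁ (refl , isolated)
      where
      isolated : Isolated a i
      isolated t (inj₂ (t<i , e)) = ℕ.<⇒≱ t<i (subst (_≤ toℕ t) (sym i≡c) (edge⇒column (t<i , e)))
      -- A neighbour t on the right would have a column of at most i, but by monotonicity its column
      -- is at least that of the successor of i, which is larger than i.
      isolated t (inj₁ (i<t , e)) = ℕ.<⇒≱ (ℕ.<-≤-trans (last i⁺ eq⁺) (column-mono i⁺ t (subst (_≤ toℕ t) (sym eq⁺) i<t)))
                                          (subst (column t ≤_) i≡c (edge⇒column (i<t , e)))
        where
        i⁺<m = ℕ.≤-<-trans i<t (Fin.toℕ<n t)
        i⁺ = fromℕ< i⁺<m
        eq⁺ = Fin.toℕ-fromℕ< i⁺<m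
    ... | inj₁ i<j = inj₂ (column⇒edge i<j (ℕ.≤-reflexive (sym i≡c)) , right , left)
      where
      right : ∀ j⁺ → toℕ j⁺ ≡ suc (toℕ j) → ¬ Adjacent a i j⁺
      right j⁺ eq (inj₁ e) = ℕ.<⇒≱ (last j⁺ eq) (subst (column j⁺ ≤_) i≡c (edge⇒column e))
      right j⁺ eq (inj₂ (j⁺<i , _)) = ℕ.<-asym i<j (ℕ.<-trans (subst (toℕ j <_) (sym eq) (ℕ.n<1+n _)) j⁺<i)
      left : ∀ i⁻ → toℕ i ≡ suc (toℕ i⁻) → ¬ Adjacent a i⁻ j
      left i⁻ eq (inj₁ e) = ℕ.<⇒≱ (subst (toℕ i⁻ <_) (sym eq) (ℕ.n<1+n _)) (subst (_≤ toℕ i⁻) (sym i≡c) (edge⇒column e))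
      left i⁻ eq (inj₂ (j<i⁻ , _)) = ℕ.<-asym i<j (ℕ.<-trans j<i⁻ (subst (toℕ i⁻ <_) (sym eq) (ℕ.n<1+n _)))

    PeakOver : Fin m → Fin m → Set
    PeakOver v j = LastInColumn j × column j ≤ toℕ v × toℕ v ≤ toℕ j

    peakOver? : ∀ v → Decidable (PeakOver v)
    peakOver? v j = lastInColumn? j ×-dec (column j ℕ.≤? toℕ v) ×-dec (toℕ v ℕ.≤? toℕ j)

    -- The left end of a peak-edge is the column of its right end, so counting pairs reduces to
    -- counting right ends.
    peakNesting≡ : ∀ v → peakNesting a v ≡ length (filter (peakOver? v) (allFin m))
    peakNesting≡ v = trans (↭-length (unique⇒↭ unique₁ unique₂ ⊆₁ ⊆₂)) (List.length-map peak (filter (peakOver? v) (allFin m)))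
      where
      column<m : ∀ j → column j < m
      column<m j = ℕ.≤-<-trans (column≤toℕ j) (Fin.toℕ<n j)
      peak : Fin m → Fin m × Fin m
      peak j = fromℕ< (column<m j) , j
      unique₁ = Unique.filter⁺ (inPeakClique? a v) (Unique.cartesianProduct⁺ (Unique.allFin⁺ m) (Unique.allFin⁺ m))
      unique₂ = Unique.map⁺ {f = peak} (cong proj₂) (Unique.filter⁺ (peakOver? v) (Unique.allFin⁺ m))
      ⊆₁ : ∀ {z} → z ∈ filter (inPeakClique? a v) (cartesianProduct (allFin m) (allFin m)) → z ∈ map peak (filter (peakOver? v) (allFin m))
      ⊆₁ {i , j} z∈ with ∈-filter⁻ (inPeakClique? a v) {xs = cartesianProduct (allFin m) (allFin m)} z∈
      ... | _ , e , i≤v , v≤j with peakEdge⇒ e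
      ... | i≡c , last = subst (_∈ map peak (filter (peakOver? v) (allFin m)))
              (cong (_, j) (Fin.toℕ-injective (trans (Fin.toℕ-fromℕ< (column<m j)) (sym i≡c))))
              (∈-map⁺ peak (∈-filter⁺ (peakOver? v) (∈-allFin j) (last , subst (_≤ toℕ v) i≡c i≤v , v≤j)))
      ⊆₂ : ∀ {z} → z ∈ map peak (filter (peakOver? v) (allFin m)) → z ∈ filter (inPeakClique? a v) (cartesianProduct (allFin m) (allFin m))
      ⊆₂ z∈ with ∈-map⁻ peak z∈
      ... | j , j∈ , refl with ∈-filter⁻ (peakOver? v) {xs = allFin m} j∈
      ... | _ , last , c≤v , v≤j = ∈-filter⁺ (inPeakClique? a v) (∈-cartesianProduct⁺ (∈-allFin _) (∈-allFin j))
              (peakEdge⇐ (Fin.toℕ-fromℕ< (column<m j)) last , subst (_≤ toℕ v) (sym (Fin.toℕ-fromℕ< (column<m j))) c≤v , v≤j)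

    -- The shape of the columns of NᵏLEᵐ⁻ᵏ when L starts with E: k entries 0, followed by entries
    -- between 1 and k. Both the Abelian property and the value of `pnest` are derived from this
    -- shape.
    module TwoBlocks (k : ℕ) (1≤k : 1 ≤ k) (k≤m : k ≤ m)
      (first : ∀ i → toℕ i < k → column i ≡ 0)
      (rest  : ∀ i → k ≤ toℕ i → 1 ≤ column i)
      (bound : ∀ i → column i ≤ k) where

      -- A vertex of column 0 is joined to the first vertex. The column of the last vertex is at
      -- most k, so the last vertex is joined to every other vertex of index at least k.
      abelian : IsAbelian a
      abelian f l i f≡0 l≡m i≢f i≢l with toℕ i ℕ.<? k
      ... | yes i<k = inj₁ (inj₂ (column⇒edge (subst (_< toℕ i) (sym f≡0) (ℕ.n≢0⇒n>0 (λ i≡0 → i≢f (Fin.toℕ-injective (trans i≡0 (sym f≡0))))))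
                                              (subst (_≤ toℕ f) (sym (first i i<k)) z≤n)))
      ... | no i≮k = inj₂ (inj₁ (column⇒edge (ℕ.≤∧≢⇒< (s≤s⁻¹ (subst (toℕ i <_) (sym l≡m) (Fin.toℕ<n i))) (i≢l ∘ Fin.toℕ-injective))
                                             (ℕ.≤-trans (bound l) (ℕ.≮⇒≥ i≮k))))

      LowPeak : Fin m → Set
      LowPeak j = LastInColumn j × column j < k

      lowPeak? : Decidable LowPeak
      lowPeak? j = lastInColumn? j ×-dec (column j ℕ.<? k)

      private
        count : {P : Fin m → Set} → Decidable P → ℕ
        count P? = length (filter P? (allFin m))

        k∸1<m : k ∸ 1 < m
        k∸1<m = subst (_≤ m) (sym (ℕ.m+[n∸m]≡n 1≤k)) k≤m

        -- Vertex k in the numbering of [m], hence index k - 1: the last N step in column 0.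
        apex : Fin m
        apex = fromℕ< k∸1<m

        suc-apex : suc (toℕ apex) ≡ k
        suc-apex = trans (cong suc (Fin.toℕ-fromℕ< k∸1<m)) (ℕ.m+[n∸m]≡n 1≤k)

        apex<k : toℕ apex < k
        apex<k = ℕ.≤-reflexive suc-apex

        apex-last : LastInColumn apex
        apex-last j⁺ eq = subst (_< column j⁺) (sym (first apex apex<k)) (rest j⁺ (ℕ.≤-reflexive (sym (trans eq suc-apex))))

        -- Before `apex` the next step is still in column 0, so no column ends there. Consequently
        -- every peak-clique whose left end is below k reaches `apex`.
        last⇒≥apex : ∀ {j} → LastInColumn j → toℕ apex ≤ toℕ j
        last⇒≥apex {j} last = ℕ.≮⇒≥ λ j<apex →
          let j⁺<m = ℕ.≤-<-trans j<apex (Fin.toℕ<n apex)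
              eq⁺ = Fin.toℕ-fromℕ< j⁺<m
              j⁺<k = subst (_< k) (sym eq⁺) (ℕ.≤-<-trans j<apex apex<k)
          in ℕ.n≮0 (subst (column j <_) (first (fromℕ< j⁺<m) j⁺<k) (last (fromℕ< j⁺<m) eq⁺))

        peakNesting-apex : peakNesting a apex ≡ count lowPeak?
        peakNesting-apex = trans (peakNesting≡ apex) (cong length (List.filter-≐ (peakOver? apex) lowPeak?
          ( (λ (last , c≤ , _) → last , ℕ.≤-<-trans c≤ apex<k)
          , (λ (last , c<k) → last , s≤s⁻¹ (subst (suc (column _) ≤_) (sym suc-apex) c<k) , last⇒≥apex last))
          (allFin m)))

        upper? : Decidable (λ j → LastInColumn j × k ≤ toℕ j × column j < k)
        upper? j = lastInColumn? j ×-dec (k ℕ.≤? toℕ j) ×-dec (column j ℕ.<? k)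

        final? : Decidable (λ j → LastInColumn j × column j ≡ k)
        final? j = lastInColumn? j ×-dec (column j ℕ.≟ k)

        final≤ : ∀ {i j} → LastInColumn i × column i ≡ k → LastInColumn j × column j ≡ k → toℕ j ≤ toℕ i
        final≤ {i} {j} (last , ci≡k) (_ , cj≡k) = ℕ.≮⇒≥ λ i<j →
          let i⁺<m = ℕ.≤-<-trans i<j (Fin.toℕ<n j)
              eq⁺ = Fin.toℕ-fromℕ< i⁺<m
          in ℕ.<⇒≱ (ℕ.<-≤-trans (last (fromℕ< i⁺<m) eq⁺) (column-mono (fromℕ< i⁺<m) j (subst (_≤ toℕ j) (sym eq⁺) i<j)))
               (ℕ.≤-reflexive (trans cj≡k (sym ci≡k)))

        -- A vertex v ≥ k misses the first peak-clique, and at most one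
        -- peak-clique contains v but not the vertex apex.
        peakNesting≤ : ∀ v → peakNesting a v ≤ count lowPeak?
        peakNesting≤ v with toℕ v ℕ.<? k
        ... | yes v<k = subst (_≤ count lowPeak?) (sym (peakNesting≡ v))
                (length-filter-⊆ (peakOver? v) lowPeak? (λ (last , c≤v , _) → last , ℕ.≤-<-trans c≤v v<k) (allFin m))
        ... | no v≮k = begin′
          peakNesting a v               ≤⟨ ℕ.≤-reflexive (peakNesting≡ v) ⟩
          count (peakOver? v)           ≤⟨ length-filter-⊆∪ (peakOver? v) upper? final? split (allFin m) ⟩
          count upper? + count final?   ≤⟨ ℕ.+-monoʳ-≤ (count upper?) (length-filter≤1 final? (λ p q → Fin.toℕ-injective (ℕ.≤-antisym (final≤ q p) (final≤ p q))) (Unique.allFin⁺ m)) ⟩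
          count upper? + 1              ≤⟨ ℕ.+-monoʳ-≤ (count upper?) (length-filter≥1 (Fin._≟ apex) (∈-allFin apex) refl) ⟩
          count upper? + count (Fin._≟ apex)
            ≤⟨ length-filter-disjoint lowPeak? upper? (Fin._≟ apex) (λ (last , _ , c<k) → last , c<k)
                 (λ { refl → apex-last , subst (_< k) (sym (first apex apex<k)) 1≤k })
                 (λ { (_ , k≤j , _) refl → ℕ.<⇒≱ apex<k k≤j }) (allFin m) ⟩
          count lowPeak? ∎′
          where
          open ℕ.≤-Reasoning using (step-≤) renaming (begin_ to begin′_; _∎ to _∎′)
          split : ∀ {j} → PeakOver v j → (LastInColumn j × k ≤ toℕ j × column j < k) ⊎ (LastInColumn j × column j ≡ k)
          split {j} (last , c≤v , v≤j) with ℕ.m≤n⇒m<n∨m≡n (bound j)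
          ... | inj₁ c<k = inj₁ (last , ℕ.≤-trans (ℕ.≮⇒≥ v≮k) v≤j , c<k)
          ... | inj₂ c≡k = inj₂ (last , c≡k)

      pnest≡ : pnest a ≡ length (filter lowPeak? (allFin m))
      pnest≡ = max≈v⁺
        (subst (_∈ map (peakNesting a) (allFin m)) peakNesting-apex (∈-map⁺ (peakNesting a) (∈-allFin apex)))
        (All.map⁺ (All.universal peakNesting≤ (allFin m))) z≤n

-- Dyck paths and their columns

columnsFrom : ℕ → Path → List ℕ
columnsFrom x []      = []
columnsFrom x (N ∷ P) = x ∷ columnsFrom x P
columnsFrom x (E ∷ P) = columnsFrom (suc x) P

AboveDiagonal : ℕ → ℕ → Path → Set
AboveDiagonal x y []      = ⊤
AboveDiagonal x y (N ∷ P) = x ≤ y × AboveDiagonal x (suc y) P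
AboveDiagonal x y (E ∷ P) = suc x ≤ y × AboveDiagonal (suc x) y P

-- Above the diagonal `y ∸ x` is not truncated, and subtracting it from y gives back x. The index is
-- offset by y because the recursion enters the path in the middle.
areas⇒columns : ∀ x y P {n} (a : Vec ℕ n) → toList a ≡ areasFrom x y P → AboveDiagonal x y P →
  toList (Vec.tabulate (λ j → (y + toℕ j) ∸ lookup a j)) ≡ columnsFrom x P
areas⇒columns x y []      Vec.[]         eq _           = refl
areas⇒columns x y (E ∷ P) a              eq (_ , above) = areas⇒columns (suc x) y P a eq above
areas⇒columns x y (N ∷ P) (c Vec.∷ a)   eq (x≤y , above) =
  cong₂ _∷_ head (trans (cong toList (Vec.tabulate-cong (λ j → cong (_∸ lookup a j) (ℕ.+-suc y (toℕ j)))))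
                        (areas⇒columns x (suc y) P a (List.∷-injectiveʳ eq) above))
  where
  head : (y + 0) ∸ c ≡ x
  head = trans (cong₂ _∸_ (ℕ.+-identityʳ y) (List.∷-injectiveˡ eq)) (ℕ.m∸[m∸n]≡n x≤y)

-- E steps before the next N step only lower the area. Applied at height `suc y`, this is the bound
-- by one more than the previous area that `areas-step` needs.
areas-head : ∀ x y P {n} (a : Vec ℕ (suc n)) → toList a ≡ areasFrom x y P → Vec.head a ≤ y ∸ x
areas-head x y (N ∷ P) (c Vec.∷ a) eq = ℕ.≤-reflexive (List.∷-injectiveˡ eq)
areas-head x y (E ∷ P) a           eq = ℕ.≤-trans (areas-head (suc x) y P a eq) (ℕ.∸-monoʳ-≤ y (ℕ.n≤1+n x))

areas-bound : ∀ x y P {n} (a : Vec ℕ n) → toList a ≡ areasFrom x y P → ∀ i → lookup a i ≤ y + toℕ i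
areas-bound x y []      Vec.[]       eq ()
areas-bound x y []      (c Vec.∷ a) () i
areas-bound x y (E ∷ P) a           eq i       = areas-bound (suc x) y P a eq i
areas-bound x y (N ∷ P) (c Vec.∷ a) eq zero    =
  subst (_≤ y + 0) (sym (List.∷-injectiveˡ eq)) (ℕ.≤-trans (ℕ.m∸n≤m y x) (ℕ.m≤m+n y 0))
areas-bound x y (N ∷ P) (c Vec.∷ a) eq (suc i) =
  subst (lookup a i ≤_) (sym (ℕ.+-suc y (toℕ i))) (areas-bound x (suc y) P a (List.∷-injectiveʳ eq) i)

areas-step : ∀ x y P {n} (a : Vec ℕ n) → toList a ≡ areasFrom x y P →
  ∀ h i → toℕ i ≡ suc (toℕ h) → lookup a i ≤ suc (lookup a h)
areas-step x y []      Vec.[]                  eq ()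
areas-step x y []      (c Vec.∷ a)             () h i i≡1+h
areas-step x y (E ∷ P) a                       eq h       i             i≡1+h = areas-step (suc x) y P a eq h i i≡1+h
areas-step x y (N ∷ P) (c Vec.∷ c′ Vec.∷ a)   eq zero    (suc zero)    i≡1+h =
  ℕ.≤-trans (areas-head x (suc y) P (c′ Vec.∷ a) (List.∷-injectiveʳ eq))
    (subst (λ z → suc y ∸ x ≤ suc z) (sym (List.∷-injectiveˡ eq))
      (ℕ.m≤n+o⇒m∸n≤o (suc y) x (subst (suc y ≤_) (sym (ℕ.+-suc x (y ∸ x))) (s≤s (ℕ.m≤n+m∸n y x)))))
areas-step x y (N ∷ P) (c Vec.∷ a)             eq (suc h) (suc i)       i≡1+h =
  areas-step x (suc y) P a (List.∷-injectiveʳ eq) h i (ℕ.suc-injective i≡1+h)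

length-areasFrom : ∀ x y P → length (areasFrom x y P) ≡ #[ N ] P
length-areasFrom x y []      = refl
length-areasFrom x y (N ∷ P) = cong suc (length-areasFrom x (suc y) P)
length-areasFrom x y (E ∷ P) = length-areasFrom (suc x) y P

columns-≥ : ∀ x P → All (x ≤_) (columnsFrom x P)
columns-≥ x []      = []
columns-≥ x (N ∷ P) = ℕ.≤-refl ∷ columns-≥ x P
columns-≥ x (E ∷ P) = All.map (ℕ.≤-trans (ℕ.n≤1+n x)) (columns-≥ (suc x) P)

columns-≤ : ∀ x P → All (_≤ x + #[ E ] P) (columnsFrom x P)
columns-≤ x []      = []
columns-≤ x (N ∷ P) = ℕ.m≤m+n x (#[ E ] P) ∷ columns-≤ x P
columns-≤ x (E ∷ P) = subst (λ z → All (_≤ z) (columnsFrom (suc x) P)) (sym (ℕ.+-suc x (#[ E ] P))) (columns-≤ (suc x) P)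

columns-++-E : ∀ x P r → columnsFrom x (P ++ replicate r E) ≡ columnsFrom x P
columns-++-E x []      zero    = refl
columns-++-E x []      (suc r) = columns-++-E (suc x) [] r
columns-++-E x (N ∷ P) r       = cong (x ∷_) (columns-++-E x P r)
columns-++-E x (E ∷ P) r       = columns-++-E (suc x) P r

columns-N-++ : ∀ k P → columnsFrom 0 (replicate k N ++ P) ≡ replicate k 0 ++ columnsFrom 0 P
columns-N-++ zero    P = refl
columns-N-++ (suc k) P = cong (0 ∷_) (columns-N-++ k P)

#-++ : ∀ s P Q → #[ s ] (P ++ Q) ≡ #[ s ] P + #[ s ] Q
#-++ s P Q = trans (cong length (List.filter-++ (s ≟ₛ_) P Q)) (List.length-++ (filter (s ≟ₛ_) P))

#N-replicate-N : ∀ k → #[ N ] (replicate k N) ≡ k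
#N-replicate-N zero    = refl
#N-replicate-N (suc k) = cong suc (#N-replicate-N k)

#E-replicate-E : ∀ k → #[ E ] (replicate k E) ≡ k
#E-replicate-E zero    = refl
#E-replicate-E (suc k) = cong suc (#E-replicate-E k)

#E-replicate-N : ∀ k → #[ E ] (replicate k N) ≡ 0
#E-replicate-N zero    = refl
#E-replicate-N (suc k) = #E-replicate-N k

#N-replicate-E : ∀ k → #[ N ] (replicate k E) ≡ 0
#N-replicate-E zero    = refl
#N-replicate-E (suc k) = #N-replicate-E k

#E+#N≡length : ∀ P → #[ E ] P + #[ N ] P ≡ length P
#E+#N≡length []      = refl
#E+#N≡length (N ∷ P) = trans (ℕ.+-suc (#[ E ] P) (#[ N ] P)) (cong suc (#E+#N≡length P))
#E+#N≡length (E ∷ P) = cong suc (#E+#N≡length P)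

aboveDiagonal-N-++ : ∀ y k P → AboveDiagonal 0 (k + y) P → AboveDiagonal 0 y (replicate k N ++ P)
aboveDiagonal-N-++ y zero    P above = above
aboveDiagonal-N-++ y (suc k) P above =
  z≤n , aboveDiagonal-N-++ (suc y) k P (subst (λ z → AboveDiagonal 0 z P) (sym (ℕ.+-suc k y)) above)

-- The starting height already covers all E steps of P, so no point of P can fall below the
-- diagonal. The final run of E steps is then controlled by its end point alone, which is the second
-- hypothesis.
aboveDiagonal-++-E : ∀ x y P r → x + #[ E ] P ≤ y → x + #[ E ] P + r ≤ y + #[ N ] P → AboveDiagonal x y (P ++ replicate r E)
aboveDiagonal-++-E x y []      zero    _  _  = tt
aboveDiagonal-++-E x y []      (suc r) h₁ h₂ = 1+x≤y , aboveDiagonal-++-E (suc x) y [] r (subst (_≤ y) (sym (ℕ.+-identityʳ (suc x))) 1+x≤y)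
    (subst (_≤ y + 0) (ℕ.+-suc (x + 0) r) h₂)
  where
  1+x≤y : suc x ≤ y
  1+x≤y = ℕ.≤-trans (s≤s (ℕ.≤-trans (ℕ.m≤m+n x 0) (ℕ.m≤m+n (x + 0) r)))
            (subst (_≤ y) (ℕ.+-suc (x + 0) r) (subst (x + 0 + suc r ≤_) (ℕ.+-identityʳ y) h₂))
aboveDiagonal-++-E x y (N ∷ P) r       h₁ h₂ =
  ℕ.≤-trans (ℕ.m≤m+n x _) h₁ , aboveDiagonal-++-E x (suc y) P r (ℕ.m≤n⇒m≤1+n h₁) (subst (x + #[ E ] P + r ≤_) (ℕ.+-suc y (#[ N ] P)) h₂)
aboveDiagonal-++-E x y (E ∷ P) r       h₁ h₂ =
  ℕ.≤-trans (ℕ.m≤m+n (suc x) _) h₁′ , aboveDiagonal-++-E (suc x) y P r h₁′ (subst (λ z → z + r ≤ y + #[ N ] P) (ℕ.+-suc x (#[ E ] P)) h₂)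
  where
  h₁′ = subst (_≤ y) (ℕ.+-suc x (#[ E ] P)) h₁

aboveDiagonal⇒inits : ∀ x y P → x ≤ y → AboveDiagonal x y P → All (λ Q → x + #[ E ] Q ≤ y + #[ N ] Q) (List.inits P)
aboveDiagonal⇒inits x y []      x≤y above = ℕ.+-monoˡ-≤ 0 x≤y ∷ []
aboveDiagonal⇒inits x y (N ∷ P) x≤y (_ , above) = ℕ.+-monoˡ-≤ 0 x≤y ∷
  All.map⁺ (All.map (λ {Q} → subst (x + #[ E ] Q ≤_) (sym (ℕ.+-suc y (#[ N ] Q)))) (aboveDiagonal⇒inits x (suc y) P (ℕ.m≤n⇒m≤1+n x≤y) above))
aboveDiagonal⇒inits x y (E ∷ P) x≤y (1+x≤y , above) = ℕ.+-monoˡ-≤ 0 x≤y ∷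
  All.map⁺ (All.map (λ {Q} → subst (_≤ y + #[ N ] Q) (sym (ℕ.+-suc x (#[ E ] Q)))) (aboveDiagonal⇒inits (suc x) y P 1+x≤y above))

-- Counting the last N steps of the columns below a bound

indicator : {P : Set} → Dec P → ℕ
indicator (yes _) = 1
indicator (no _)  = 0

indicator-yes : {P : Set} (P? : Dec P) → P → indicator P? ≡ 1
indicator-yes (yes _) p = refl
indicator-yes (no ¬p) p = contradiction p ¬p

indicator-no : {P : Set} (P? : Dec P) → ¬ P → indicator P? ≡ 0
indicator-no (yes p) ¬p = contradiction p ¬p
indicator-no (no _)  ¬p = refl

indicator-cong : {P Q : Set} (P? : Dec P) (Q? : Dec Q) → (P → Q) → (Q → P) → indicator P? ≡ indicator Q?
indicator-cong (yes p) Q? P⇒Q Q⇒P = sym (indicator-yes Q? (P⇒Q p))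
indicator-cong (no ¬p) Q? P⇒Q Q⇒P = sym (indicator-no Q? (¬p ∘ Q⇒P))

length-filter-∷ : {A : Set} {P : A → Set} (P? : Decidable P) → ∀ x xs →
  length (filter P? (x ∷ xs)) ≡ indicator (P? x) + length (filter P? xs)
length-filter-∷ P? x xs with P? x
... | yes _ = refl
... | no _  = refl

lastCount : ℕ → List ℕ → ℕ
lastCount K []           = 0
lastCount K (x ∷ [])     = indicator (x ℕ.<? K)
lastCount K (x ∷ z ∷ xs) = indicator ((x ℕ.<? z) ×-dec (x ℕ.<? K)) + lastCount K (z ∷ xs)

IsLast : ∀ {n} → ℕ → (Fin n → ℕ) → Fin n → Set
IsLast K c j = (∀ j⁺ → toℕ j⁺ ≡ suc (toℕ j) → c j < c j⁺) × c j < K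

-- The decision procedure is arbitrary because the one used for the tail `c ∘ suc` quantifies over a
-- smaller `Fin` and is not the restriction of the given one.
lastCount-tabulate : ∀ {n} K (c : Fin n → ℕ) (last? : Decidable (IsLast K c)) →
  length (filter last? (allFin n)) ≡ lastCount K (toList (Vec.tabulate c))
lastCount-tabulate {zero}  K c last? = refl
lastCount-tabulate {suc n} K c last? = begin
  length (filter last? (allFin (suc n)))
    ≡⟨ length-filter-∷ last? zero (tabulate suc) ⟩
  indicator (last? zero) + length (filter last? (tabulate suc))
    ≡⟨ cong (λ l → indicator (last? zero) + length (filter last? l)) (List.map-tabulate id suc) ⟨
  indicator (last? zero) + length (filter last? (map suc (allFin n)))
    ≡⟨ cong (λ x → indicator (last? zero) + x) (length-filter-map last? suc (allFin n)) ⟩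
  indicator (last? zero) + length (filter (last? ∘ suc) (allFin n))
    ≡⟨ cong (λ x → indicator (last? zero) + x) (cong length (List.filter-≐ (last? ∘ suc) last?′ (down , up) (allFin n))) ⟩
  indicator (last? zero) + length (filter last?′ (allFin n))
    ≡⟨ cong (λ x → indicator (last? zero) + x) (lastCount-tabulate K (c ∘ suc) last?′) ⟩
  indicator (last? zero) + lastCount K (toList (Vec.tabulate (c ∘ suc)))
    ≡⟨ head n c last? ⟩
  lastCount K (toList (Vec.tabulate c)) ∎
  where
  last?′ : Decidable (IsLast K (c ∘ suc))
  last?′ j = (Fin.all? λ j⁺ → (toℕ j⁺ ℕ.≟ suc (toℕ j)) →-dec (c (suc j) ℕ.<? c (suc j⁺))) ×-dec (c (suc j) ℕ.<? K)
  down : ∀ {j} → IsLast K c (suc j) → IsLast K (c ∘ suc) j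
  down (last , c<K) = (λ j⁺ eq → last (suc j⁺) (cong suc eq)) , c<K
  up : ∀ {j} → IsLast K (c ∘ suc) j → IsLast K c (suc j)
  up (last , c<K) = (λ { (suc j⁺) eq → last j⁺ (ℕ.suc-injective eq) }) , c<K
  head : ∀ n (c : Fin (suc n) → ℕ) (last? : Decidable (IsLast K c)) →
    indicator (last? zero) + lastCount K (toList (Vec.tabulate (c ∘ suc))) ≡ lastCount K (toList (Vec.tabulate c))
  head zero    c last? = trans (ℕ.+-identityʳ _) (indicator-cong (last? zero) (c zero ℕ.<? K) proj₂ (λ c<K → (λ { zero () }) , c<K))
  head (suc n) c last? = cong (_+ lastCount K (toList (Vec.tabulate (c ∘ suc))))
    (indicator-cong (last? zero) ((c zero ℕ.<? c (suc zero)) ×-dec (c zero ℕ.<? K))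
      (λ (last , c<K) → last (suc zero) refl , c<K)
      (λ (c< , c<K) → (λ { (suc zero) eq → c< }) , c<K))

lastCount-∷ : ∀ K x xs → All (x <_) xs → x < K → lastCount K (x ∷ xs) ≡ suc (lastCount K xs)
lastCount-∷ K x []       _          x<K = indicator-yes (x ℕ.<? K) x<K
lastCount-∷ K x (z ∷ xs) (x<z ∷ _) x<K =
  cong (_+ lastCount K (z ∷ xs)) (indicator-yes ((x ℕ.<? z) ×-dec (x ℕ.<? K)) (x<z , x<K))

-- The path ends in column K. An N step followed by E ends its column, and this column lies below K
-- because an E step is still to come; an N step at the very end lies in column K and is excluded by
-- the bound. Hence the counted steps are the factors NE.
lastCount-columns : ∀ K x w → x + #[ E ] w ≡ K → lastCount K (columnsFrom x w) ≡ peaks E w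
lastCount-columns K x []          eq = refl
lastCount-columns K x (E ∷ w)     eq = lastCount-columns K (suc x) w (trans (sym (ℕ.+-suc x (#[ E ] w))) eq)
lastCount-columns K x (N ∷ [])    eq = indicator-no (x ℕ.<? K) (ℕ.<-irrefl (trans (sym (ℕ.+-identityʳ x)) eq))
lastCount-columns K x (N ∷ N ∷ w) eq = trans
  (cong (_+ lastCount K (x ∷ columnsFrom x w)) (indicator-no ((x ℕ.<? x) ×-dec (x ℕ.<? K)) (λ (x<x , _) → ℕ.<-irrefl refl x<x)))
  (lastCount-columns K x (N ∷ w) eq)
lastCount-columns K x (N ∷ E ∷ w) eq = trans
  (lastCount-∷ K x (columnsFrom (suc x) w) (columns-≥ (suc x) w) (subst (x <_) eq (ℕ.m<m+n x z<s)))
  (cong suc (lastCount-columns K (suc x) w (trans (sym (ℕ.+-suc x (#[ E ] w))) eq)))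

-- The Dyck path NᵏLEᵐ⁻ᵏ with L = Ew.
abelianPath : Path → Path
abelianPath w = replicate (suc (#[ E ] w)) N ++ (E ∷ w) ++ replicate (#[ N ] w) E

#N-abelianPath : ∀ w → #[ N ] (abelianPath w) ≡ suc (length w)
#N-abelianPath w = begin
  #[ N ] (abelianPath w)
    ≡⟨ #-++ N (replicate (suc (#[ E ] w)) N) _ ⟩
  #[ N ] (replicate (suc (#[ E ] w)) N) + #[ N ] (w ++ replicate (#[ N ] w) E)
    ≡⟨ cong₂ _+_ (#N-replicate-N (suc (#[ E ] w))) (#-++ N w _) ⟩
  suc (#[ E ] w) + (#[ N ] w + #[ N ] (replicate (#[ N ] w) E))
    ≡⟨ cong (λ x → suc (#[ E ] w) + (#[ N ] w + x)) (#N-replicate-E (#[ N ] w)) ⟩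
  suc (#[ E ] w) + (#[ N ] w + 0)
    ≡⟨ cong (λ x → suc (#[ E ] w) + x) (ℕ.+-identityʳ _) ⟩
  suc (#[ E ] w + #[ N ] w)
    ≡⟨ cong suc (#E+#N≡length w) ⟩
  suc (length w) ∎

#E-abelianPath : ∀ w → #[ E ] (abelianPath w) ≡ suc (length w)
#E-abelianPath w = begin
  #[ E ] (abelianPath w)
    ≡⟨ #-++ E (replicate (suc (#[ E ] w)) N) _ ⟩
  #[ E ] (replicate (suc (#[ E ] w)) N) + suc (#[ E ] (w ++ replicate (#[ N ] w) E))
    ≡⟨ cong₂ _+_ (#E-replicate-N (suc (#[ E ] w))) (cong suc (#-++ E w _)) ⟩
  suc (#[ E ] w + #[ E ] (replicate (#[ N ] w) E))
    ≡⟨ cong (λ x → suc (#[ E ] w + x)) (#E-replicate-E (#[ N ] w)) ⟩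
  suc (#[ E ] w + #[ N ] w)
    ≡⟨ cong suc (#E+#N≡length w) ⟩
  suc (length w) ∎

abelianPath-above : ∀ w → AboveDiagonal 0 0 (abelianPath w)
abelianPath-above w = aboveDiagonal-N-++ 0 k _ (subst (λ z → AboveDiagonal 0 z ((E ∷ w) ++ replicate (#[ N ] w) E)) (sym (ℕ.+-identityʳ k))
  (aboveDiagonal-++-E 0 k (E ∷ w) (#[ N ] w) ℕ.≤-refl ℕ.≤-refl))
  where k = suc (#[ E ] w)

abelianPath-isDyck : ∀ w → IsDyckPath (suc (length w)) (abelianPath w)
abelianPath-isDyck w = #N-abelianPath w , #E-abelianPath w , aboveDiagonal⇒inits 0 0 _ z≤n (abelianPath-above w)

columns-abelianPath : ∀ w → columnsFrom 0 (abelianPath w) ≡ replicate (suc (#[ E ] w)) 0 ++ columnsFrom 1 w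
columns-abelianPath w = trans (columns-N-++ (suc (#[ E ] w)) _)
  (cong (replicate (suc (#[ E ] w)) 0 ++_) (columns-++-E 1 w (#[ N ] w)))

lookup-prefix : ∀ k {x : ℕ} {xs n} (c : Vec ℕ n) → toList c ≡ replicate k x ++ xs → ∀ i → toℕ i < k → lookup c i ≡ x
lookup-prefix (suc k) (d Vec.∷ c) eq zero    i<k = List.∷-injectiveˡ eq
lookup-prefix (suc k) (d Vec.∷ c) eq (suc i) i<k = lookup-prefix k c (List.∷-injectiveʳ eq) i (s≤s⁻¹ i<k)

lookup-suffix : {P : ℕ → Set} → ∀ k {x xs n} (c : Vec ℕ n) → toList c ≡ replicate k x ++ xs → All P xs →
  ∀ i → k ≤ toℕ i → P (lookup c i)
lookup-suffix zero    (d Vec.∷ c) refl (p ∷ ps) zero    _   = p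
lookup-suffix zero    (d Vec.∷ c) refl (p ∷ ps) (suc i) _   = lookup-suffix zero {0} c refl ps i z≤n
lookup-suffix (suc k) (d Vec.∷ c) eq   ps       (suc i) k≤i = lookup-suffix k c (List.∷-injectiveʳ eq) ps i (s≤s⁻¹ k≤i)

-- Only the list of entries of `a` is prescribed, not its length. This covers both `areaVec`, of
-- length `suc m`, and `areaSequence`, whose length is that of a computed list.
module _ (w : Path) {n : ℕ} (a : Vec ℕ n) (areas : toList a ≡ areasFrom 0 0 (abelianPath w)) where

  open Columns a

  private
    k : ℕ
    k = suc (#[ E ] w)

  areas-isAreaSequence : IsAreaSequence a
  areas-isAreaSequence = areas-bound 0 0 (abelianPath w) a areas , areas-step 0 0 (abelianPath w) a areas

  columns≡ : toList (Vec.tabulate column) ≡ columnsFrom 0 (abelianPath w)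
  columns≡ = areas⇒columns 0 0 (abelianPath w) a areas (abelianPath-above w)

  private
    split : toList (Vec.tabulate column) ≡ replicate k 0 ++ columnsFrom 1 w
    split = trans columns≡ (columns-abelianPath w)

    first : ∀ i → toℕ i < k → column i ≡ 0
    first i i<k = trans (sym (Vec.lookup∘tabulate column i)) (lookup-prefix k (Vec.tabulate column) split i i<k)

    rest : ∀ i → k ≤ toℕ i → 1 ≤ column i × column i ≤ k
    rest i k≤i = subst (λ z → 1 ≤ z × z ≤ k) (Vec.lookup∘tabulate column i)
      (lookup-suffix k (Vec.tabulate column) split (All.zip (columns-≥ 1 w , columns-≤ 1 w)) i k≤i)

    bound : ∀ i → column i ≤ k
    bound i with toℕ i ℕ.<? k
    ... | yes i<k = subst (_≤ k) (sym (first i i<k)) z≤n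
    ... | no i≮k  = proj₂ (rest i (ℕ.≮⇒≥ i≮k))

    k≤n : k ≤ n
    k≤n = subst (k ≤_) (begin
      suc (#[ E ] w + #[ N ] w) ≡⟨ cong suc (#E+#N≡length w) ⟩
      suc (length w)            ≡⟨ #N-abelianPath w ⟨
      #[ N ] (abelianPath w)    ≡⟨ length-areasFrom 0 0 (abelianPath w) ⟨
      length (areasFrom 0 0 (abelianPath w)) ≡⟨ cong length areas ⟨
      length (toList a)         ≡⟨ Vec.length-toList a ⟩
      n                         ∎) (ℕ.m≤m+n k (#[ N ] w))

  open Monotone areas-isAreaSequence
  open TwoBlocks k (s≤s z≤n) k≤n first (λ i k≤i → proj₁ (rest i k≤i)) bound

  areas-isAbelian : IsAbelian a
  areas-isAbelian = abelian

  pnest-abelianPath : pnest a ≡ suc (peaks E w)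
  pnest-abelianPath = begin
    pnest a                                           ≡⟨ pnest≡ ⟩
    length (filter lowPeak? (allFin n))              ≡⟨ lastCount-tabulate k column lowPeak? ⟩
    lastCount k (toList (Vec.tabulate column))        ≡⟨ cong (lastCount k) columns≡ ⟩
    -- The final run of E steps affects no column, but it would break the equation between k and the
    -- number of E steps that `lastCount-columns` requires, so it is removed.
    lastCount k (columnsFrom 0 (abelianPath w))       ≡⟨ cong (lastCount k) (trans (columns-N-++ k _) (cong (replicate k 0 ++_) (columns-++-E 1 w (#[ N ] w)))) ⟩
    lastCount k (replicate k 0 ++ columnsFrom 1 w)    ≡⟨ cong (lastCount k) (columns-N-++ k (E ∷ w)) ⟨
    lastCount k (columnsFrom 0 (replicate k N ++ E ∷ w)) ≡⟨ lastCount-columns k 0 (replicate k N ++ E ∷ w) #E≡k ⟩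
    -- The additional peak is the junction between Nᵏ and the initial E of L.
    peaks E (replicate k N ++ E ∷ w)                ≡⟨ peaks-prefix (#[ E ] w) ⟩
    suc (peaks E w)                                 ∎
    where
    #E≡k : #[ E ] (replicate k N ++ E ∷ w) ≡ k
    #E≡k = trans (#-++ E (replicate k N) (E ∷ w)) (cong (_+ k) (#E-replicate-N k))
    peaks-prefix : ∀ l → peaks N (replicate l N ++ E ∷ w) ≡ suc (peaks E w)
    peaks-prefix zero    = refl
    peaks-prefix (suc l) = peaks-prefix l

-- Abelian area sequences and Dyck paths as binary words

-- The columns do not see E steps after the last N step, so the number of E steps has to be given as
-- well.
columnsFrom-injective : ∀ x P Q → columnsFrom x P ≡ columnsFrom x Q → #[ E ] P ≡ #[ E ] Q → P ≡ Q
columnsFrom-injective x []      []      _  _  = refl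
columnsFrom-injective x (N ∷ P) (N ∷ Q) eq e  = cong (N ∷_) (columnsFrom-injective x P Q (List.∷-injectiveʳ eq) e)
columnsFrom-injective x (E ∷ P) (E ∷ Q) eq e  = cong (E ∷_) (columnsFrom-injective (suc x) P Q eq (ℕ.suc-injective e))
columnsFrom-injective x (N ∷ P) (E ∷ Q) eq e  with subst (All (suc x ≤_)) (sym eq) (columns-≥ (suc x) Q)
... | x<x ∷ _ = contradiction x<x (ℕ.<-irrefl refl)
columnsFrom-injective x (E ∷ P) (N ∷ Q) eq e  with subst (All (suc x ≤_)) eq (columns-≥ (suc x) P)
... | x<x ∷ _ = contradiction x<x (ℕ.<-irrefl refl)
columnsFrom-injective x []      (N ∷ Q) () e
columnsFrom-injective x []      (E ∷ Q) eq ()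
columnsFrom-injective x (N ∷ P) []      () e
columnsFrom-injective x (E ∷ P) []      eq ()

toList-++-injectiveˡ : ∀ {m} (v w : Vec Step m) {xs ys} → toList v ++ xs ≡ toList w ++ ys → v ≡ w
toList-++-injectiveˡ Vec.[]      Vec.[]      eq = refl
toList-++-injectiveˡ (s Vec.∷ v) (t Vec.∷ w) eq =
  cong₂ Vec._∷_ (List.∷-injectiveˡ eq) (toList-++-injectiveˡ v w (List.∷-injectiveʳ eq))

abelianPath-injective : ∀ {m} (v w : Vec Step m) → abelianPath (toList v) ≡ abelianPath (toList w) → v ≡ w
abelianPath-injective v w eq = toList-++-injectiveˡ v w (after-N (suc (#[ E ] (toList v))) (suc (#[ E ] (toList w))) eq)
  where
  after-N : ∀ k l {P Q} → replicate k N ++ E ∷ P ≡ replicate l N ++ E ∷ Q → P ≡ Q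
  after-N zero    zero    eq = List.∷-injectiveʳ eq
  after-N (suc k) (suc l) eq = after-N k l (List.∷-injectiveʳ eq)
  after-N zero    (suc l) ()
  after-N (suc k) zero    ()

length-areas : ∀ {m} (w : Vec Step m) → length (areasFrom 0 0 (abelianPath (toList w))) ≡ suc m
length-areas w = trans (length-areasFrom 0 0 (abelianPath (toList w)))
  (trans (#N-abelianPath (toList w)) (cong suc (Vec.length-toList w)))

areaVec : ∀ {m} → Vec Step m → Vec ℕ (suc m)
areaVec w = Vec.cast (length-areas w) (Vec.fromList (areasFrom 0 0 (abelianPath (toList w))))

toList-areaVec : ∀ {m} (w : Vec Step m) → toList (areaVec w) ≡ areasFrom 0 0 (abelianPath (toList w))
toList-areaVec w = trans (Vec.toList-cast (length-areas w) _) (Vec.toList∘fromList _)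

areaVec-columns : ∀ {m} (w : Vec Step m) →
  toList (Vec.tabulate (Columns.column (areaVec w))) ≡ columnsFrom 0 (abelianPath (toList w))
areaVec-columns w = columns≡ (toList w) (areaVec w) (toList-areaVec w)

areaVec-injective : ∀ {m} {v w : Vec Step m} → areaVec v ≡ areaVec w → v ≡ w
areaVec-injective {m} {v} {w} eq = abelianPath-injective v w (columnsFrom-injective 0 _ _
  (trans (sym (areaVec-columns v)) (trans (cong (λ a → toList (Vec.tabulate (Columns.column a))) eq) (areaVec-columns w)))
  (trans (#E-abelianPath (toList v)) (trans (cong suc (trans (Vec.length-toList v) (sym (Vec.length-toList w)))) (sym (#E-abelianPath (toList w))))))

tabulate-All : ∀ {n} {P : ℕ → Set} (c : Fin n → ℕ) → (∀ i → P (c i)) → All P (toList (Vec.tabulate c))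
tabulate-All {zero}  c p = []
tabulate-All {suc n} c p = p zero ∷ tabulate-All (c ∘ suc) (p ∘ suc)

tabulate-sorted : ∀ {n} (c : Fin n → ℕ) → (∀ i j → toℕ i ≤ toℕ j → c i ≤ c j) → AllPairs _≤_ (toList (Vec.tabulate c))
tabulate-sorted {zero}  c mono = []
tabulate-sorted {suc n} c mono =
  tabulate-All (c ∘ suc) (λ j → mono zero (suc j) z≤n) ∷ tabulate-sorted (c ∘ suc) (λ i j i≤j → mono (suc i) (suc j) (s≤s i≤j))

splitZeros : ∀ xs → AllPairs _≤_ xs → ∃[ k ] ∃[ ys ] xs ≡ replicate k 0 ++ ys × All (1 ≤_) ys × AllPairs _≤_ ys
splitZeros []           _              = 0 , [] , refl , [] , []
splitZeros (suc x ∷ xs) (x≤xs ∷ xs↗) = 0 , suc x ∷ xs , refl , s≤s z≤n ∷ All.map (ℕ.≤-trans (s≤s z≤n)) x≤xs , x≤xs ∷ xs↗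
splitZeros (zero ∷ xs)  (_ ∷ xs↗) with splitZeros xs xs↗
... | k , ys , eq , 1≤ys , ys↗ = suc k , ys , cong (0 ∷_) eq , 1≤ys , ys↗

columnsFrom-E-++ : ∀ x r P → columnsFrom x (replicate r E ++ P) ≡ columnsFrom (x + r) P
columnsFrom-E-++ x zero    P = cong (λ y → columnsFrom y P) (sym (ℕ.+-identityʳ x))
columnsFrom-E-++ x (suc r) P = trans (columnsFrom-E-++ (suc x) r P) (cong (λ y → columnsFrom y P) (sym (ℕ.+-suc x r)))

length-columnsFrom : ∀ x P → length (columnsFrom x P) ≡ #[ N ] P
length-columnsFrom x []      = refl
length-columnsFrom x (N ∷ P) = cong suc (length-columnsFrom x P)
length-columnsFrom x (E ∷ P) = length-columnsFrom (suc x) P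

-- Between consecutive columns one inserts as many E steps as their difference, and the bound K
-- fixes the length of the final run.
columnsFrom-surjective : ∀ x K xs → x ≤ K → All (x ≤_) xs → All (_≤ K) xs → AllPairs _≤_ xs →
  ∃[ w ] columnsFrom x w ≡ xs × x + #[ E ] w ≡ K
columnsFrom-surjective x K []       x≤K _            _             _ =
  replicate (K ∸ x) E , columns-++-E x [] (K ∸ x) , trans (cong (λ y → x + y) (#E-replicate-E (K ∸ x))) (ℕ.m+[n∸m]≡n x≤K)
columnsFrom-surjective x K (y ∷ xs) x≤K (x≤y ∷ _) (y≤K ∷ xs≤K) (y≤xs ∷ xs↗)
  with columnsFrom-surjective y K xs y≤K y≤xs xs≤K xs↗
... | w , columns , eq = replicate (y ∸ x) E ++ N ∷ w
  , trans (columnsFrom-E-++ x (y ∸ x) (N ∷ w)) (trans (cong (λ z → columnsFrom z (N ∷ w)) (ℕ.m+[n∸m]≡n x≤y)) (cong (y ∷_) columns))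
  , (begin
      x + #[ E ] (replicate (y ∸ x) E ++ N ∷ w)     ≡⟨ cong (λ z → x + z) (#-++ E (replicate (y ∸ x) E) (N ∷ w)) ⟩
      x + (#[ E ] (replicate (y ∸ x) E) + #[ E ] w) ≡⟨ cong (λ z → x + (z + #[ E ] w)) (#E-replicate-E (y ∸ x)) ⟩
      x + (y ∸ x + #[ E ] w)                        ≡⟨ ℕ.+-assoc x (y ∸ x) _ ⟨
      x + (y ∸ x) + #[ E ] w                        ≡⟨ cong (_+ #[ E ] w) (ℕ.m+[n∸m]≡n x≤y) ⟩
      y + #[ E ] w                                  ≡⟨ eq ⟩
      K                                             ∎)

column-injective : ∀ {m} (a b : Vec ℕ m) → (∀ i → lookup a i ≤ toℕ i) → (∀ i → lookup b i ≤ toℕ i) →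
  toList (Vec.tabulate (Columns.column a)) ≡ toList (Vec.tabulate (Columns.column b)) → a ≡ b
column-injective a b a≤ b≤ eq = trans (sym (Vec.tabulate∘lookup a)) (trans (Vec.tabulate-cong pointwise) (Vec.tabulate∘lookup b))
  where
  open Columns
  tabulate≡ : Vec.tabulate (column a) ≡ Vec.tabulate (column b)
  tabulate≡ = trans (sym (Vec.cast-is-id refl _)) (Vec.toList-injective refl (Vec.tabulate (column a)) (Vec.tabulate (column b)) eq)
  pointwise : ∀ i → lookup a i ≡ lookup b i
  pointwise i = begin
    lookup a i              ≡⟨ ℕ.m∸[m∸n]≡n (a≤ i) ⟨
    toℕ i ∸ column a i      ≡⟨ cong (λ z → toℕ i ∸ z) (Vec.lookup∘tabulate (column a) i) ⟨
    toℕ i ∸ lookup (Vec.tabulate (column a)) i ≡⟨ cong (λ v → toℕ i ∸ lookup v i) tabulate≡ ⟩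
    toℕ i ∸ lookup (Vec.tabulate (column b)) i ≡⟨ cong (λ z → toℕ i ∸ z) (Vec.lookup∘tabulate (column b) i) ⟩
    toℕ i ∸ column b i      ≡⟨ ℕ.m∸[m∸n]≡n (b≤ i) ⟩
    lookup b i              ∎

module _ {m : ℕ} (a : Vec ℕ (suc m)) (area : IsAreaSequence a) (abelian : IsAbelian a) where

  open Columns a
  open Monotone area

  private
    cs : List ℕ
    cs = toList (Vec.tabulate column)

    -- This is where the Abelian property enters. The vertex of index k has a positive column and is
    -- not joined to the first vertex, so unless it is itself the last vertex it is joined to the
    -- last one. In either case the last column is at most k, and monotonicity bounds the others.
    column-bound : ∀ k ys → cs ≡ replicate k 0 ++ ys → All (1 ≤_) ys → 1 ≤ k → ∀ i → column i ≤ k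
    column-bound k ys eq 1≤ys 1≤k i with toℕ i ℕ.<? k
    ... | yes i<k = subst (_≤ k) (trans (sym (lookup-prefix k (Vec.tabulate column) eq i i<k)) (Vec.lookup∘tabulate column i)) z≤n
    ... | no i≮k  = ℕ.≤-trans (column-mono i last i≤last) last≤k
      where
      last : Fin (suc m)
      last = Fin.fromℕ m
      i≤last : toℕ i ≤ toℕ last
      i≤last = subst (toℕ i ≤_) (sym (Fin.toℕ-fromℕ m)) (s≤s⁻¹ (Fin.toℕ<n i))
      k<1+m : k < suc m
      k<1+m = ℕ.≤-<-trans (ℕ.≮⇒≥ i≮k) (Fin.toℕ<n i)
      j : Fin (suc m)
      j = fromℕ< k<1+m
      j≡k : toℕ j ≡ k
      j≡k = Fin.toℕ-fromℕ< k<1+m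
      1≤column : 1 ≤ column j
      1≤column = subst (1 ≤_) (Vec.lookup∘tabulate column j) (lookup-suffix k (Vec.tabulate column) eq 1≤ys j (ℕ.≤-reflexive (sym j≡k)))
      last≤k : column last ≤ k
      last≤k with j Fin.≟ last
      ... | yes j≡last = ℕ.≤-trans (column≤toℕ last) (ℕ.≤-reflexive (trans (cong toℕ (sym j≡last)) j≡k))
      ... | no j≢last with abelian zero last j refl (cong suc (Fin.toℕ-fromℕ m)) (λ j≡0 → ℕ.<⇒≢ 1≤k (trans (cong toℕ (sym j≡0)) j≡k)) j≢last
      ...   | inj₁ (inj₁ (() , _))
      ...   | inj₁ (inj₂ e) = contradiction (edge⇒column e) (ℕ.<⇒≱ 1≤column)
      ...   | inj₂ (inj₁ e) = subst (column last ≤_) j≡k (edge⇒column e)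
      ...   | inj₂ (inj₂ (last<j , _)) = contradiction (subst (_< toℕ j) (Fin.toℕ-fromℕ m) last<j) (ℕ.<⇒≱ (Fin.toℕ<n j))

    1≤prefix : ∀ k ys → cs ≡ replicate k 0 ++ ys → All (1 ≤_) ys → 1 ≤ k
    1≤prefix zero    ys eq 1≤ys = contradiction (subst (1 ≤_) (Vec.lookup∘tabulate column zero) (lookup-suffix zero {0} (Vec.tabulate column) eq 1≤ys zero z≤n))
                                                (ℕ.≤⇒≯ (column≤toℕ zero))
    1≤prefix (suc k) ys eq 1≤ys = s≤s z≤n

  areaVec-surjective : ∃[ w ] a ≡ areaVec {m} w
  areaVec-surjective with splitZeros cs (tabulate-sorted column column-mono)
  ... | k , ys , eq , 1≤ys , ys↗ with 1≤prefix k ys eq 1≤ys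
  ... | 1≤k with columnsFrom-surjective 1 k ys 1≤k 1≤ys
                   (All.++⁻ʳ (replicate k 0) (subst (All (_≤ k)) eq (tabulate-All column (column-bound k ys eq 1≤ys 1≤k)))) ys↗
  -- The word `w` runs from column 1 to column k, so it has k - 1 letters E; matching on `refl`
  -- replaces k by `suc (#[ E ] w)`, the length of the initial run in `abelianPath w`.
  ... | w , columns , refl = v , column-injective a (areaVec v) (proj₁ area)
        (proj₁ (areas-isAreaSequence (toList v) (areaVec v) (toList-areaVec v))) (begin
          cs                                            ≡⟨ eq ⟩
          replicate k 0 ++ ys                           ≡⟨ cong (replicate k 0 ++_) columns ⟨
          replicate k 0 ++ columnsFrom 1 w              ≡⟨ columns-abelianPath w ⟨
          columnsFrom 0 (abelianPath w)                 ≡⟨ cong (λ u → columnsFrom 0 (abelianPath u)) toList-v ⟨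
          columnsFrom 0 (abelianPath (toList v))        ≡⟨ areaVec-columns v ⟨
          toList (Vec.tabulate (Columns.column (areaVec v))) ∎)
    where
    length-w : length w ≡ m
    length-w = ℕ.suc-injective (begin
      suc (length w)                       ≡⟨ cong suc (#E+#N≡length w) ⟨
      k + #[ N ] w                         ≡⟨ cong (λ z → k + z) (length-columnsFrom 1 w) ⟨
      k + length (columnsFrom 1 w)         ≡⟨ cong₂ (λ x y → x + length y) (sym (List.length-replicate k)) columns ⟩
      length (replicate k 0) + length ys   ≡⟨ List.length-++ (replicate k 0) ⟨
      length (replicate k 0 ++ ys)         ≡⟨ cong length eq ⟨
      length cs                            ≡⟨ Vec.length-toList (Vec.tabulate column) ⟩
      suc m                                ∎)
    v : Vec Step m
    v = Vec.cast length-w (Vec.fromList w)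
    toList-v : toList v ≡ w
    toList-v = trans (Vec.toList-cast length-w _) (Vec.toList∘fromList w)

-- Abelian area sequences listed by words, and the coefficients of `Pnest`

words-unique : {A : Set} {xs : List A} → Unique xs → ∀ n → Unique (words xs n)
words-unique xs! zero    = [] ∷ []
words-unique xs! (suc n) = Unique.cartesianProductWith⁺ Vec._∷_ Vec.∷-injective xs! (words-unique xs! n)

∈-words : {A : Set} {xs : List A} → ∀ {n} (v : Vec A n) → (∀ i → lookup v i ∈ xs) → v ∈ words xs n
∈-words Vec.[]      _   = here refl
∈-words (x Vec.∷ v) ∈xs = ∈-cartesianProductWith⁺ Vec._∷_ (∈xs zero) (∈-words v (∈xs ∘ suc))

letters-unique : Unique letters
letters-unique = ((λ ()) ∷ []) ∷ [] ∷ []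

∈-letters : ∀ s → s ∈ letters
∈-letters N = here refl
∈-letters E = there (here refl)

𝒜↭ : ∀ m → 𝒜 (suc m) ↭ map areaVec (words letters m)
𝒜↭ m = unique⇒↭
  (Unique.filter⁺ _ (words-unique (Unique.upTo⁺ (suc m)) (suc m)))
  (Unique.map⁺ areaVec-injective (words-unique letters-unique m)) ⊆₁ ⊆₂
  where
  ⊆₁ : ∀ {a} → a ∈ 𝒜 (suc m) → a ∈ map areaVec (words letters m)
  ⊆₁ {a} a∈ with ∈-filter⁻ _ {xs = words (upTo (suc m)) (suc m)} a∈
  ... | _ , area , abelian with areaVec-surjective a area abelian
  ... | w , refl = ∈-map⁺ areaVec (∈-words w (λ i → ∈-letters (lookup w i)))
  ⊆₂ : ∀ {a} → a ∈ map areaVec (words letters m) → a ∈ 𝒜 (suc m)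
  ⊆₂ a∈ with ∈-map⁻ areaVec a∈
  ... | w , _ , refl = ∈-filter⁺ _
      (∈-words (areaVec w) (λ i → ∈-upTo⁺ (ℕ.≤-<-trans (proj₁ area i) (Fin.toℕ<n i)))) (area , areas-isAbelian (toList w) (areaVec w) (toList-areaVec w))
    where area = areas-isAreaSequence (toList w) (areaVec w) (toList-areaVec w)

coeff-X^ : ∀ r j → coeff (X ^ₚ r) j ≡ + indicator (r ℕ.≟ j)
coeff-X^ zero    zero    = refl
coeff-X^ zero    (suc j) = refl
coeff-X^ (suc r) zero    = coeff-X⊗-zero (X ^ₚ r)
coeff-X^ (suc r) (suc j) = begin
  coeff (X ^ₚ suc r) (suc j)         ≡⟨ coeff-X⊗-suc (X ^ₚ r) j ⟩
  coeff (X ^ₚ r) j                   ≡⟨ coeff-X^ r j ⟩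
  + indicator (r ℕ.≟ j)              ≡⟨ cong +_ (indicator-cong (r ℕ.≟ j) (suc r ℕ.≟ suc j) (cong suc) ℕ.suc-injective) ⟩
  + indicator (suc r ℕ.≟ suc j)      ∎

coeff-sum-X^ : {A : Set} (f : A → ℕ) → ∀ xs j →
  coeff (sumₚ (map (λ x → X ^ₚ f x) xs)) j ≡ + length (filter (λ x → f x ℕ.≟ j) xs)
coeff-sum-X^ f []       j = refl
coeff-sum-X^ f (x ∷ xs) j = begin
  coeff (X ^ₚ f x ⊕ sumₚ (map (λ x → X ^ₚ f x) xs)) j
    ≡⟨ coeff-⊕ (X ^ₚ f x) _ j ⟩
  coeff (X ^ₚ f x) j ℤ.+ coeff (sumₚ (map (λ x → X ^ₚ f x) xs)) j
    ≡⟨ cong₂ ℤ._+_ (coeff-X^ (f x) j) (coeff-sum-X^ f xs j) ⟩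
  + (indicator (f x ℕ.≟ j) + length (filter (λ x → f x ℕ.≟ j) xs))
    ≡⟨ cong +_ (length-filter-∷ (λ x → f x ℕ.≟ j) x xs) ⟨
  + length (filter (λ x → f x ℕ.≟ j) (x ∷ xs)) ∎

coeff-Pnest : ∀ m j → coeff (Pnest (suc m)) j ≡ + wordCount (λ w → suc (peaks E w) ℕ.≟ j) m
coeff-Pnest m j = trans (coeff-sum-X^ pnest (𝒜 (suc m)) j) (cong +_ (begin
  length (filter (λ a → pnest a ℕ.≟ j) (𝒜 (suc m)))
    ≡⟨ ↭-length (filter-↭ (λ a → pnest a ℕ.≟ j) (𝒜↭ m)) ⟩
  length (filter (λ a → pnest a ℕ.≟ j) (map areaVec (words letters m)))
    ≡⟨ length-filter-map (λ a → pnest a ℕ.≟ j) areaVec (words letters m) ⟩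
  length (filter (λ w → pnest (areaVec w) ℕ.≟ j) (words letters m))
    ≡⟨ cong length (List.filter-≐ (λ w → pnest (areaVec w) ℕ.≟ j) (λ w → suc (peaks E (toList w)) ℕ.≟ j)
         ((λ {w} → trans (sym (pnest-areaVec w))) , (λ {w} → trans (pnest-areaVec w))) (words letters m)) ⟩
  wordCount (λ w → suc (peaks E w) ℕ.≟ j) m ∎))
  where
  pnest-areaVec : ∀ w → pnest (areaVec w) ≡ suc (peaks E (toList w))
  pnest-areaVec w = pnest-abelianPath (toList w) (areaVec w) (toList-areaVec w)

-- The size is a variable with an equation because `2 * n`, as in the theorem, and `n * 2`, as in
-- the binomial identities, are not convertible.
coeff-Pnest-zero : ∀ {l} m → l ≡ suc m → coeff (Pnest l) 0 ≡ + 0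
coeff-Pnest-zero m refl = trans (coeff-Pnest m 0) (cong +_ (wordCount-none (λ w → suc (peaks E w) ℕ.≟ 0) (λ w ()) m))

coeff-Pnest-suc : ∀ {l} m j → l ≡ suc m → coeff (Pnest l) (suc j) ≡ + (l C suc (j * 2))
coeff-Pnest-suc m j refl = trans (coeff-Pnest m (suc j)) (cong +_ (trans
  (wordCount-cong (λ w → suc (peaks E w) ℕ.≟ suc j) (peaks? E j) (ℕ.suc-injective , cong suc) m)
  (wordCount-peaks-E m j)))

-- The avoidance condition in terms of windows

Forbidden : Path → Set
Forbidden P = P ≡ E ∷ N ∷ E ∷ [] ⊎ P ≡ N ∷ E ∷ N ∷ []

allowed⇒ : ∀ {a b c} → Allowed a b c → ¬ Forbidden (a ∷ b ∷ c ∷ [])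
allowed⇒ () (inj₁ refl)
allowed⇒ () (inj₂ refl)

allowed⇐ : ∀ a b c → ¬ Forbidden (a ∷ b ∷ c ∷ []) → Allowed a b c
allowed⇐ E N E ok = ok (inj₁ refl)
allowed⇐ N E N ok = ok (inj₂ refl)
allowed⇐ N N N _  = tt
allowed⇐ N N E _  = tt
allowed⇐ N E E _  = tt
allowed⇐ E N N _  = tt
allowed⇐ E E N _  = tt
allowed⇐ E E E _  = tt

window : ℕ → Path → Path
window j P = List.take 3 (List.drop (2 * j) P)

window-suc : ∀ j a b P → window (suc j) (a ∷ b ∷ P) ≡ window j P
window-suc j a b P = cong (λ i → List.take 3 (List.drop i (a ∷ b ∷ P))) (ℕ.*-suc 2 j)

avoids⇒ : ∀ n c P → length P ≡ n * 2 → Avoids c P → ∀ (j : Fin n) → ¬ Forbidden (window (toℕ j) (c ∷ P))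
avoids⇒ (suc n) c (s ∷ c′ ∷ P) eq (ok , _)  zero    bad = allowed⇒ ok bad
avoids⇒ (suc n) c (s ∷ c′ ∷ P) eq (_ , oks) (suc j) bad =
  avoids⇒ n c′ P (ℕ.suc-injective (ℕ.suc-injective eq)) oks j (subst Forbidden (window-suc (toℕ j) c s (c′ ∷ P)) bad)

-- With 2n letters after `c`, the recursion of `Avoids` takes two letters for each window and ends
-- exactly after the n-th one.
avoids⇐ : ∀ n c P → length P ≡ n * 2 → (∀ (j : Fin n) → ¬ Forbidden (window (toℕ j) (c ∷ P))) → Avoids c P
avoids⇐ zero    c []           eq ok = tt
avoids⇐ (suc n) c (s ∷ c′ ∷ P) eq ok = allowed⇐ c s c′ (ok zero) ,
  avoids⇐ n c′ P (ℕ.suc-injective (ℕ.suc-injective eq)) (λ j bad → ok (suc j) (subst Forbidden (sym (window-suc (toℕ j) c s (c′ ∷ P))) bad))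

-- Abelian Dyck paths listed by words, and the count of the avoiding ones

toPair : ∀ {m} → Vec Step m → Pair (suc m)
toPair w = suc (#[ E ] (toList w)) , E Vec.∷ w

toPath-toPair : ∀ {m} (w : Vec Step m) → toPath (toPair w) ≡ abelianPath (toList w)
toPath-toPair {m} w = cong (λ r → replicate (suc (#[ E ] (toList w))) N ++ (E ∷ toList w) ++ replicate r E) (begin
  m ∸ #[ E ] (toList w)                                          ≡⟨ cong (_∸ #[ E ] (toList w)) (trans (#E+#N≡length (toList w)) (Vec.length-toList w)) ⟨
  #[ E ] (toList w) + #[ N ] (toList w) ∸ #[ E ] (toList w)      ≡⟨ ℕ.m+n∸m≡n (#[ E ] (toList w)) _ ⟩
  #[ N ] (toList w)                                              ∎)

toPair-areas : ∀ {m} (w : Vec Step m) → toList (areaSequence (toPath (toPair w))) ≡ areasFrom 0 0 (abelianPath (toList w))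
toPair-areas w = trans (Vec.toList∘fromList _) (cong (areasFrom 0 0) (toPath-toPair w))

isPair⇒ : ∀ {m} (p : Pair (suc m)) → IsPair p → ∃[ w ] p ≡ toPair w
isPair⇒ (k , s Vec.∷ w) (_ , #E≡k , _ , head≡E) with refl ← Maybe.just-injective head≡E = w , cong (_, E Vec.∷ w) (sym #E≡k)

isPair-toPair : ∀ {m} (w : Vec Step m) → IsPair (toPair w)
isPair-toPair {m} w = (s≤s z≤n , s≤s (subst (#[ E ] (toList w) ≤_) total (ℕ.m≤m+n _ _))) , refl , cong suc total , refl
  where
  total : #[ E ] (toList w) + #[ N ] (toList w) ≡ m
  total = trans (#E+#N≡length (toList w)) (Vec.length-toList w)

isAbelianDyckPath-toPair : ∀ {m} (w : Vec Step m) → IsAbelianDyckPath (suc m) (toPath (toPair w))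
isAbelianDyckPath-toPair {m} w =
    subst (IsDyckPath (suc m)) (sym (toPath-toPair w))
      (subst (λ l → IsDyckPath (suc l) (abelianPath (toList w))) (Vec.length-toList w) (abelianPath-isDyck (toList w)))
  , areas-isAbelian (toList w) (areaSequence (toPath (toPair w))) (toPair-areas w)

abelianDyckPaths-unique : ∀ m → Unique (abelianDyckPaths m)
abelianDyckPaths-unique m = Unique.filter⁺ _
  (Unique.cartesianProduct⁺ (Unique.map⁺ ℕ.suc-injective (Unique.upTo⁺ m)) (words-unique letters-unique m))

∈-abelianDyckPaths⁻ : ∀ m {p} → p ∈ abelianDyckPaths m → IsPair p
∈-abelianDyckPaths⁻ m p∈ = proj₁ (proj₂ (∈-filter⁻ _ {xs = cartesianProduct (map suc (upTo m)) (words letters m)} p∈))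

∈-abelianDyckPaths⁺ : ∀ m {p} → IsPair p → IsAbelianDyckPath m (toPath p) → p ∈ abelianDyckPaths m
∈-abelianDyckPaths⁺ m {suc k , L} pair dyck = ∈-filter⁺ _
  (∈-cartesianProduct⁺ (∈-map⁺ suc (∈-upTo⁺ (proj₂ (proj₁ pair)))) (∈-words L (λ j → ∈-letters (lookup L j))))
  (pair , dyck)

avoidingPaths-unique : ∀ n r → Unique (avoidingPaths n r)
avoidingPaths-unique n r = Unique.filter⁺ _ (abelianDyckPaths-unique (2 * n))

pnest-toPath : ∀ {m} (p : Pair m) w → toPath p ≡ abelianPath w → pnest (areaSequence (toPath p)) ≡ suc (peaks E w)
pnest-toPath p w eq = pnest-abelianPath w (areaSequence (toPath p)) (trans (Vec.toList∘fromList _) (cong (areasFrom 0 0) eq))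

∈-avoidingPaths⁻ : ∀ n i {p} w → toPath p ≡ abelianPath w → p ∈ avoidingPaths n (suc i) →
  peaks E w ≡ i × AvoidsENEandNEN {n} (proj₂ p)
∈-avoidingPaths⁻ n i {p} w eq p∈ =
  let (_ , pnest≡1+i , avoids) = ∈-filter⁻ _ {xs = abelianDyckPaths (2 * n)} p∈
  in ℕ.suc-injective (trans (sym (pnest-toPath p w eq)) pnest≡1+i) , avoids

avoidingPaths⊆abelianDyckPaths : ∀ n r {p} → p ∈ avoidingPaths n r → p ∈ abelianDyckPaths (2 * n)
avoidingPaths⊆abelianDyckPaths n r p∈ = proj₁ (∈-filter⁻ _ {xs = abelianDyckPaths (2 * n)} p∈)

∈-avoidingPaths⁺ : ∀ n i {p} w → toPath p ≡ abelianPath w → p ∈ abelianDyckPaths (2 * n) →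
  peaks E w ≡ i → AvoidsENEandNEN {n} (proj₂ p) → p ∈ avoidingPaths n (suc i)
∈-avoidingPaths⁺ n i {p} w eq p∈ peaks≡i avoids =
  ∈-filter⁺ _ p∈ (trans (pnest-toPath p w eq) (cong suc peaks≡i) , avoids)

module _ (m i : ℕ) where

  private
    -- `2 * suc m` reduces to `suc M`, so `toPair` maps words of length M into `Pair (2 * suc m)`
    -- without a cast.
    M = m + suc (m + 0)

    M≡ : M ≡ suc (m * 2)
    M≡ = ℕ.suc-injective (ℕ.*-comm 2 (suc m))

    augmented : Vec Step M → Path
    augmented w = toList w ++ N ∷ []

    length-augmented : ∀ w → length (augmented w) ≡ suc m * 2
    length-augmented w = begin
      length (toList w ++ N ∷ [])   ≡⟨ List.length-++ (toList w) ⟩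
      length (toList w) + 1         ≡⟨ cong (_+ 1) (trans (Vec.length-toList w) M≡) ⟩
      suc (m * 2) + 1               ≡⟨ ℕ.+-comm (suc (m * 2)) 1 ⟩
      suc m * 2                     ∎

    avoidingWord? : Decidable (λ (w : Vec Step M) → Avoiding E i (toList w))
    avoidingWord? w = avoiding? E i (toList w)

  private
    encoded : List (Pair (2 * suc m))
    encoded = map toPair (filter avoidingWord? (words letters M))

    ⊆encoded : ∀ {p} → ∃[ w ] p ≡ toPair w → p ∈ avoidingPaths (suc m) (suc i) → p ∈ encoded
    ⊆encoded (w , refl) p∈ =
      let (peaks≡i , avoids) = ∈-avoidingPaths⁻ (suc m) i {toPair w} (toList w) (toPath-toPair w) p∈
      in ∈-map⁺ toPair (∈-filter⁺ avoidingWord? (∈-words w (λ j → ∈-letters (lookup w j)))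
          (peaks≡i , avoids⇐ (suc m) E (augmented w) (length-augmented w) (λ j bad → avoids (j , bad))))

    encoded⊆ : ∀ {p} → ∃[ w ] w ∈ filter avoidingWord? (words letters M) × p ≡ toPair w → p ∈ avoidingPaths (suc m) (suc i)
    encoded⊆ (w , w∈ , refl) =
      let (_ , peaks≡i , avoids) = ∈-filter⁻ avoidingWord? {xs = words letters M} w∈
      in ∈-avoidingPaths⁺ (suc m) i {toPair w} (toList w) (toPath-toPair w)
          (∈-abelianDyckPaths⁺ (2 * suc m) (isPair-toPair w) (isAbelianDyckPath-toPair w))
          peaks≡i
          (λ (j , bad) → avoids⇒ (suc m) E (augmented w) (length-augmented w) avoids j bad)

    encoded-unique : Unique encoded
    encoded-unique = Unique.map⁺ (λ {v} {w} eq → proj₂ (Vec.∷-injective (cong proj₂ eq)))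
      (Unique.filter⁺ avoidingWord? (words-unique letters-unique M))

  avoidingPaths↭ : avoidingPaths (suc m) (suc i) ↭ encoded
  avoidingPaths↭ = unique⇒↭ (avoidingPaths-unique (suc m) (suc i)) encoded-unique
    (λ {p} p∈ → ⊆encoded (isPair⇒ p (∈-abelianDyckPaths⁻ (2 * suc m) (avoidingPaths⊆abelianDyckPaths (suc m) (suc i) p∈))) p∈)
    (λ p∈ → encoded⊆ (∈-map⁻ toPair p∈))

  length-avoidingPaths : length (avoidingPaths (suc m) (suc i)) ≡ gammaCoeff (suc m) i
  length-avoidingPaths = begin
    length (avoidingPaths (suc m) (suc i))                            ≡⟨ ↭-length avoidingPaths↭ ⟩
    length encoded ≡⟨ List.length-map toPair (filter avoidingWord? (words letters M)) ⟩
    wordCount (avoiding? E i) M                                        ≡⟨ cong (wordCount (avoiding? E i)) M≡ ⟩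
    wordCount (avoiding? E i) (suc (m * 2))                            ≡⟨ wordCount-avoiding-E m i ⟩
    gammaCoeff (suc m) i                                              ∎

-- Division of `Pnest` by t and conclusion

coeff-drop-1 : ∀ p i → coeff (List.drop 1 p) i ≡ coeff p (suc i)
coeff-drop-1 []      i = refl
coeff-drop-1 (c ∷ p) i = refl

-- Division by t discards the constant term; for `Pnest` this is harmless because every peak-nesting
-- that occurs is a successor.
X⊗drop-1 : ∀ p → coeff p 0 ≡ + 0 → X ⊗ List.drop 1 p ≈ p
X⊗drop-1 p p₀≡0 zero    = trans (coeff-X⊗-zero (List.drop 1 p)) (sym p₀≡0)
X⊗drop-1 p p₀≡0 (suc i) = trans (coeff-X⊗-suc (List.drop 1 p) i) (coeff-drop-1 p i)

module _ (m : ℕ) {l : ℕ} (l≡ : l ≡ suc m * 2) where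

  coeff-drop-Pnest : ∀ j → coeff (List.drop 1 (Pnest l)) j ≡ + (suc m * 2 C suc (j * 2))
  coeff-drop-Pnest j = trans (coeff-drop-1 (Pnest l) j)
    (trans (coeff-Pnest-suc (suc (m * 2)) j l≡) (cong (λ k → + (k C suc (j * 2))) l≡))

  Pnest-gamma : ∃[ p ] ∃[ γ ]
      X ⊗ p ≈ Pnest l
    × IsGammaPolynomial p γ
    × γ ≈ closedForm (suc m)
    × (const (+ 2) ⊗ X) ⊗ (γ ∘ₚ (X ^ₚ 2)) ≈ (const (+ 1) ⊕ const (+ 2) ⊗ X) ^ₚ suc m ⊖ (const (+ 1) ⊖ const (+ 2) ⊗ X) ^ₚ suc m
  Pnest-gamma = List.drop 1 (Pnest l) , closedForm (suc m)
    , X⊗drop-1 (Pnest l) (coeff-Pnest-zero (suc (m * 2)) l≡)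
    , closedForm-isGamma m (List.drop 1 (Pnest l)) coeff-drop-Pnest
    , (λ _ → refl)
    , closedForm-√ m

proposition4p7 : ∀ (n : ℕ) → 1 ≤ n →
    (∃[ p ] ∃[ γ ]
    X ⊗ p ≈ Pnest (2 * n)
    × IsGammaPolynomial p γ
    × γ ≈ ∑≤ ((n ∸ 1) / 2) (λ i → const (+ (2 ^ (2 * i + 1) * (n C (2 * i + 1)))) ⊗ X ^ₚ i)
    × (const (+ 2) ⊗ X) ⊗ (γ ∘ₚ (X ^ₚ 2)) ≈ (const (+ 1) ⊕ const (+ 2) ⊗ X) ^ₚ n ⊖ (const (+ 1) ⊖ const (+ 2) ⊗ X) ^ₚ n)
    × (∀ (i : ℕ) → i ≤ (n ∸ 1) / 2 → 2 ^ (2 * i + 1) * (n C (2 * i + 1)) ≡ length (avoidingPaths n (suc i)))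
proposition4p7 (suc m) _ = Pnest-gamma m (ℕ.*-comm 2 (suc m)) ,
  λ i _ → trans (cong (λ k → 2 ^ k * (suc m C k)) (2*i+1≡ i)) (sym (length-avoidingPaths m i))
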